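{- For every co-maximal set $C\subseteq\omega$ there exist two isomorphic computable structures $\mathcal{A}$ and $\mathcal{B}$ (for the same computable language) such that the cohesive powers $\Pi_C\mathcal{A}$ and $\Pi_C\mathcal{B}$ are not isomorphic.
   Context: $\omega$ denotes the set of natural numbers. $X\subseteq^* Y$ means that $X\setminus Y$ is finite. An infinite set $C\subseteq\omega$ is cohesive if for every c.e. set $W$, either $W\cap C$ or $\overline{W}\cap C$ is finite. A set $M\subseteq\omega$ is maximal if $M$ is c.e. and $\overline{M}$ is cohesive. A set is co-maximal if it is the complement of a maximal set (so co-maximal sets are cohesive). A computable structure for a computable first-order language $L$ is one whose domain is a computable subset of $\omega$ and whose functions and relations are uniformly computable. Cohesive power: let $\mathcal{A}$ be a computable structure for $L$ with domain $A$, and let $C\subseteq\omega$ be cohesive. Let $D$ be the set of partial computable functions $\varphi:\omega\to A$ with $C\subseteq^*\mathrm{dom}(\varphi)$. For $\varphi_1,\varphi_2\in D$ put $\varphi_1=_C\varphi_2$ iff $C\subseteq^*\{x:\varphi_1(x){\downarrow}=\varphi_2(x){\downarrow}\}$. The cohesive power $\Pi_C\mathcal{A}$ is the $L$-structure with domain $D/{=_C}$, where: an $n$-ary function symbol $f$ is interpreted by $f([\varphi_1],\ldots,[\varphi_n])=[\varphi]$ with $\varphi(x)\simeq f^{\mathcal{A}}(\varphi_1(x),\ldots,\varphi_n(x))$ for all $x\in\omega$; an $m$-ary predicate symbol $P$ is interpreted by: $P([\varphi_1],\ldots,[\varphi_m])$ holds iff $C\subseteq^*\{x\in\omega: P^{\mathcal{A}}(\varphi_1(x),\ldots,\varphi_m(x))\}$;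 a constant symbol $c$ is interpreted as the class of the constant function with value $c^{\mathcal{A}}$. -}

module Defs where

open import Level using (0ℓ)
open import Data.Bool.Base using (Bool; true; false; T)
open import Data.Empty using (⊥-elim)
open import Data.Fin.Base using (Fin; zero; suc)
open import Data.List.Base using (List; []; _++_)
open import Data.List.Membership.Propositional using (_∈_)
open import Data.List.Membership.Propositional.Properties using (∈-++⁺ˡ; ∈-++⁺ʳ)
open import Data.List.Membership.DecPropositional using () renaming (_∈?_ to mem?)
open import Data.Nat.Base using (ℕ; zero; suc; _+_; _<_)
open import Data.Nat.Properties using (<-cmp; 0≢1+n; _≟_)
open import Data.Product using (∃; ∃-syntax; _×_; _,_; proj₁; proj₂)
open import Data.Sum.Base using (_⊎_)
open import Data.Unit.Base using (⊤; tt)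
open import Data.Vec.Base using (Vec; []; _∷_; lookup; map)
open import Data.Vec.Relation.Binary.Pointwise.Inductive using (Pointwise; []; _∷_)
open import Function.Bundles using (Bijection; _⇔_; mk⇔)
open import Relation.Binary.Bundles using (Setoid)
open import Relation.Binary.Definitions using (tri<; tri≈; tri>)
open import Relation.Binary.PropositionalEquality using (_≡_; refl; sym; cong; cong₂; subst; setoid)
open import Relation.Nullary using (¬_; yes; no)
open import Relation.Unary using (Pred; ∁; _∩_; _∖_; _≐_) renaming (_⊆_ to _⊆ₚ_)

------------------------------------------------------------------------
-- Partial recursive functions

data PR : ℕ → Set where
  Z    : ∀ {n} → PR n
  S    : PR 1
  proj : ∀ {n} → Fin n → PR n
  comp : ∀ {m n} → PR m → Vec (PR n) m → PR n
  prec : ∀ {n} → PR n → PR (suc (suc n)) → PR (suc n)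
  mu   : ∀ {n} → PR (suc n) → PR n

private
  variable
    m n : ℕ

Graph : ℕ → Set₁
Graph n = Vec ℕ n → ℕ → Set

Prec : Graph n → Graph (suc (suc n)) → ℕ → Graph n
Prec F G zero    xs y = F xs y
Prec F G (suc i) xs y = ∃[ r ] Prec F G i xs r × G (i ∷ r ∷ xs) y

-- ⟦ p ⟧ xs y : the computation of p on input xs converges with output y.

⟦_⟧  : PR n → Graph n
⟦_⟧* : Vec (PR n) m → Vec ℕ n → Vec ℕ m → Set

⟦ Z         ⟧ xs       y = y ≡ 0
⟦ S         ⟧ (x ∷ []) y = y ≡ suc x
⟦ proj i    ⟧ xs       y = y ≡ lookup xs i
⟦ comp f gs ⟧ xs       y = ∃[ zs ] ⟦ gs ⟧* xs zs × ⟦ f ⟧ zs y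
⟦ prec f g  ⟧ (i ∷ xs) y = Prec ⟦ f ⟧ ⟦ g ⟧ i xs y
⟦ mu f      ⟧ xs       y =
  ⟦ f ⟧ (y ∷ xs) 0 × (∀ z → z < y → ∃[ r ] ⟦ f ⟧ (z ∷ xs) (suc r))

⟦ []     ⟧* xs []       = ⊤
⟦ g ∷ gs ⟧* xs (z ∷ zs) = ⟦ g ⟧ xs z × ⟦ gs ⟧* xs zs

deterministic  : (p : PR n) → ∀ {xs y z} → ⟦ p ⟧ xs y → ⟦ p ⟧ xs z → y ≡ z
deterministic* : (ps : Vec (PR n) m) → ∀ {xs ys zs} →
                 ⟦ ps ⟧* xs ys → ⟦ ps ⟧* xs zs → ys ≡ zs

deterministic Z        refl refl = refl
deterministic S        {_ ∷ []} refl refl = refl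
deterministic (proj i) refl refl = refl
deterministic (comp f gs) (us , u , v) (us′ , u′ , v′)
  with refl ← deterministic* gs u u′ = deterministic f v v′
deterministic (prec f g) {i ∷ xs} = go i
  where
  go : ∀ i {y z} → Prec ⟦ f ⟧ ⟦ g ⟧ i xs y → Prec ⟦ f ⟧ ⟦ g ⟧ i xs z → y ≡ z
  go zero    p q = deterministic f p q
  go (suc i) (_ , p , p′) (_ , q , q′)
    with refl ← go i p q = deterministic g p′ q′
deterministic (mu f) {y = y} {z = z} (p , p<) (q , q<) with <-cmp y z
... | tri< y<z _ _ = ⊥-elim (0≢1+n (deterministic f p (proj₂ (q< y y<z))))
... | tri≈ _ y≡z _ = y≡z
... | tri> _ _ z<y = ⊥-elim (0≢1+n (deterministic f q (proj₂ (p< z z<y))))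

deterministic* []       {ys = []}    {[]}    _       _         = refl
deterministic* (p ∷ ps) {ys = _ ∷ _} {_ ∷ _} (u , v) (u′ , v′) =
  cong₂ _∷_ (deterministic p u u′) (deterministic* ps v v′)

------------------------------------------------------------------------
-- Coding of tuples by Cantor's pairing function

triangular : ℕ → ℕ
triangular zero    = 0
triangular (suc i) = suc (i + triangular i)

pair : ℕ → ℕ → ℕ
pair x y = triangular (x + y) + y

⟨_⟩ : Vec ℕ n → ℕ
⟨ []     ⟩ = 0
⟨ x ∷ xs ⟩ = pair x ⟨ xs ⟩

constᴾ : ℕ → PR n
constᴾ zero    = Z
constᴾ (suc c) = comp S (constᴾ c ∷ [])

addᴾ : PR 2
addᴾ = prec (proj zero) (comp S (proj (suc zero) ∷ []))

triangularᴾ : PR 1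
triangularᴾ = prec Z (comp S (comp addᴾ (proj zero ∷ proj (suc zero) ∷ []) ∷ []))

pairᴾ : PR 2
pairᴾ = comp addᴾ (comp triangularᴾ (addᴾ ∷ []) ∷ proj (suc zero) ∷ [])

tupleᴾ : Vec (PR n) m → PR n
tupleᴾ []       = Z
tupleᴾ (p ∷ ps) = comp pairᴾ (p ∷ tupleᴾ ps ∷ [])

constᴾ-correct : ∀ c (xs : Vec ℕ n) → ⟦ constᴾ c ⟧ xs c
constᴾ-correct zero    xs = refl
constᴾ-correct (suc c) xs = c ∷ [] , (constᴾ-correct c xs , tt) , refl

addᴾ-correct : ∀ x y → ⟦ addᴾ ⟧ (x ∷ y ∷ []) (x + y)
addᴾ-correct zero    y = refl
addᴾ-correct (suc x) y = x + y , addᴾ-correct x y , x + y ∷ [] , (refl , tt) , refl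

triangularᴾ-correct : ∀ x → ⟦ triangularᴾ ⟧ (x ∷ []) (triangular x)
triangularᴾ-correct zero    = refl
triangularᴾ-correct (suc x) =
  triangular x , triangularᴾ-correct x ,
  _ , ((_ , (refl , refl , tt) , addᴾ-correct x (triangular x)) , tt) , refl

pairᴾ-correct : ∀ x y → ⟦ pairᴾ ⟧ (x ∷ y ∷ []) (pair x y)
pairᴾ-correct x y =
  triangular (x + y) ∷ y ∷ [] ,
  ((x + y ∷ [] , (addᴾ-correct x y , tt) , triangularᴾ-correct (x + y)) , refl , tt) ,
  addᴾ-correct (triangular (x + y)) y

tupleᴾ-correct : (ps : Vec (PR n) m) → ∀ {xs ys} →
                 ⟦ ps ⟧* xs ys → ⟦ tupleᴾ ps ⟧ xs ⟨ ys ⟩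
tupleᴾ-correct []       {ys = []}     _       = refl
tupleᴾ-correct (p ∷ ps) {ys = y ∷ ys} (u , v) =
  y ∷ ⟨ ys ⟩ ∷ [] , (u , tupleᴾ-correct ps v , tt) , pairᴾ-correct y ⟨ ys ⟩

tupleᴾ-converges : (ps : Vec (PR n) m) → ∀ {xs t} →
                   ⟦ tupleᴾ ps ⟧ xs t → ∃[ ys ] ⟦ ps ⟧* xs ys
tupleᴾ-converges []       _ = [] , tt
tupleᴾ-converges (p ∷ ps) (y ∷ _ ∷ [] , (u , v , _) , _) =
  let ys , vs = tupleᴾ-converges ps v in y ∷ ys , u , vs

------------------------------------------------------------------------
-- Sets of natural numbers

-- Containment in a list, rather than equality with one: constructively this
-- makes subsets of finite sets finite, and classically it is no different.

Finite : Pred ℕ 0ℓ → Set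
Finite X = ∃[ l ] X ⊆ₚ (_∈ l)

infix 4 _⊆*_

_⊆*_ : Pred ℕ 0ℓ → Pred ℕ 0ℓ → Set
X ⊆* Y = Finite (X ∖ Y)

dom : PR 1 → Pred ℕ 0ℓ
dom p x = ∃[ y ] ⟦ p ⟧ (x ∷ []) y

CE : Pred ℕ 0ℓ → Set
CE W = ∃[ p ] W ≐ dom p

Cohesive : Pred ℕ 0ℓ → Set₁
Cohesive C = ¬ Finite C × (∀ W → CE W → Finite (W ∩ C) ⊎ Finite (∁ W ∩ C))

Maximal : Pred ℕ 0ℓ → Set₁
Maximal M = CE M × Cohesive (∁ M)

CoMaximal : Pred ℕ 0ℓ → Set₁
CoMaximal C = ∃[ M ] Maximal M × C ≐ ∁ M

⊆*-weaken : ∀ {X Y Y′ : Pred ℕ 0ℓ} → Y ⊆ₚ Y′ → X ⊆* Y → X ⊆* Y′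
⊆*-weaken Y⊆Y′ (l , h) = l , λ (x , ¬y′) → h (x , λ y → ¬y′ (Y⊆Y′ y))

⊆*-total : ∀ {X Y : Pred ℕ 0ℓ} → (∀ x → Y x) → X ⊆* Y
⊆*-total all = [] , λ (_ , ¬y) → ⊥-elim (¬y (all _))

⊆*-∩ : ∀ {X Y Y′ : Pred ℕ 0ℓ} → X ⊆* Y → X ⊆* Y′ → X ⊆* (Y ∩ Y′)
⊆*-∩ {X} {Y} {Y′} (l , h) (l′ , h′) = l ++ l′ , both
  where
  both : (X ∖ (Y ∩ Y′)) ⊆ₚ (_∈ l ++ l′)
  both {x} (x∈X , ¬yy′) with mem? _≟_ x l | mem? _≟_ x l′
  ... | yes i | _     = ∈-++⁺ˡ i
  ... | no _  | yes j = ∈-++⁺ʳ l j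
  ... | no ¬i | no ¬j = ⊥-elim (¬i (h (x∈X , λ y → ¬j (h′ (x∈X , λ y′ → ¬yy′ (y , y′))))))

------------------------------------------------------------------------
-- Computable languages and structures

bit : Bool → ℕ
bit false = 0
bit true  = 1

record ComputableSet : Set where
  field
    char          : ℕ → Bool
    charᴾ         : PR 1
    charᴾ-correct : ∀ x → ⟦ charᴾ ⟧ (x ∷ []) (bit (char x))

  Element : Set
  Element = ∃[ x ] T (char x)

open ComputableSet public using (Element)

record Language : Set where
  field
    functions predicates constants : ComputableSet
    farity          : Element functions → ℕ
    farityᴾ         : PR 1
    farityᴾ-correct : ∀ f → ⟦ farityᴾ ⟧ (proj₁ f ∷ []) (farity f)
    parity          : Element predicates → ℕ
    parityᴾ         : PR 1
    parityᴾ-correct : ∀ P → ⟦ parityᴾ ⟧ (proj₁ P ∷ []) (parity P)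

-- Structures with a setoid as domain, so that quotients are available.

record Structure (L : Language) : Set₁ where
  open Language L
  field
    domain : Setoid 0ℓ 0ℓ
  open Setoid domain public using (Carrier; _≈_)
  field
    fun       : ∀ f → Vec Carrier (farity f) → Carrier
    fun-cong  : ∀ f {as bs} → Pointwise _≈_ as bs → fun f as ≈ fun f bs
    pred      : ∀ P → Vec Carrier (parity P) → Set
    pred-resp : ∀ P {as bs} → Pointwise _≈_ as bs → pred P as → pred P bs
    const     : Element constants → Carrier

infix 4 _≅_

record _≅_ {L : Language} (𝓜 𝓝 : Structure L) : Set where
  open Language L
  private
    module M = Structure 𝓜
    module N = Structure 𝓝
  field
    bijection : Bijection M.domain N.domain
  open Bijection bijection public using (to)
  field
    preserves-fun   : ∀ f as → to (M.fun f as) N.≈ N.fun f (map to as)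
    preserves-pred  : ∀ P as → M.pred P as ⇔ N.pred P (map to as)
    preserves-const : ∀ c → to (M.const c) N.≈ N.const c

-- One program computes all functions, taking the symbol and the coded tuple
-- of arguments as its inputs; likewise for predicates and for constants.

record ComputableStructure (L : Language) : Set where
  open Language L
  field
    universe : ComputableSet

  Dom : Set
  Dom = Element universe

  field
    nonempty : Dom
    fun      : ∀ f → Vec Dom (farity f) → Dom
    pred     : ∀ P → Vec Dom (parity P) → Bool
    const    : Element constants → Dom
    funᴾ predᴾ : PR 2
    constantᴾ  : PR 1
    funᴾ-correct : ∀ f as →
      ⟦ funᴾ ⟧ (proj₁ f ∷ ⟨ map proj₁ as ⟩ ∷ []) (proj₁ (fun f as))
    predᴾ-correct : ∀ P as →
      ⟦ predᴾ ⟧ (proj₁ P ∷ ⟨ map proj₁ as ⟩ ∷ []) (bit (pred P as))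
    constantᴾ-correct : ∀ c → ⟦ constantᴾ ⟧ (proj₁ c ∷ []) (proj₁ (const c))

Pointwise-≡ : ∀ {A : Set} {as bs : Vec A n} → Pointwise _≡_ as bs → as ≡ bs
Pointwise-≡ []       = refl
Pointwise-≡ (e ∷ es) = cong₂ _∷_ e (Pointwise-≡ es)

structure : ∀ {L} → ComputableStructure L → Structure L
structure 𝓐 = record
  { domain    = setoid Dom
  ; fun       = fun
  ; fun-cong  = λ f es → cong (fun f) (Pointwise-≡ es)
  ; pred      = λ P as → T (pred P as)
  ; pred-resp = λ P es → subst (λ as → T (pred P as)) (Pointwise-≡ es)
  ; const     = const
  }
  where open ComputableStructure 𝓐

------------------------------------------------------------------------
-- Cohesive powers

module CohesivePower {L : Language} (C : Pred ℕ 0ℓ) (𝓐 : ComputableStructure L) where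
  open Language L
  open ComputableStructure 𝓐

  -- A representative program of a partial computable φ : ω → A.

  record D : Set where
    field
      program : PR 1
      into    : ∀ x y → ⟦ program ⟧ (x ∷ []) y → T (ComputableSet.char universe y)
      almost  : C ⊆* dom program

  open D public

  _at_↓_ : D → ℕ → Dom → Set
  φ at x ↓ a = ⟦ program φ ⟧ (x ∷ []) (proj₁ a)

  _at*_↓_ : Vec D n → ℕ → Vec Dom n → Set
  φs at* x ↓ as = Pointwise (λ φ a → φ at x ↓ a) φs as

  infix 4 _=ᶜ_

  _=ᶜ_ : D → D → Set
  φ =ᶜ ψ = C ⊆* λ x → ∃[ a ] φ at x ↓ a × ψ at x ↓ a

  =ᶜ-refl : ∀ {φ} → φ =ᶜ φ
  =ᶜ-refl {φ} =
    ⊆*-weaken (λ { (y , r) → (y , into φ _ y r) , r , r }) (almost φ)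

  =ᶜ-sym : ∀ {φ ψ} → φ =ᶜ ψ → ψ =ᶜ φ
  =ᶜ-sym = ⊆*-weaken λ (a , r , s) → a , s , r

  =ᶜ-trans : ∀ {φ ψ χ} → φ =ᶜ ψ → ψ =ᶜ χ → φ =ᶜ χ
  =ᶜ-trans {φ} {ψ} {χ} e e′ =
    ⊆*-weaken
      (λ { ((a , r , s) , (b , s′ , t)) →
           b , subst (⟦ program φ ⟧ _) (deterministic (program ψ) s s′) r , t })
      (⊆*-∩ e e′)

  D/=ᶜ : Setoid 0ℓ 0ℓ
  D/=ᶜ = record
    { Carrier       = D
    ; _≈_           = _=ᶜ_
    ; isEquivalence = record
      { refl  = λ {φ} → =ᶜ-refl {φ}
      ; sym   = λ {φ} {ψ} → =ᶜ-sym {φ} {ψ}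
      ; trans = λ {φ} {ψ} {χ} → =ᶜ-trans {φ} {ψ} {χ}
      }
    }

  ↓*⇒⟦⟧* : ∀ {x} {φs : Vec D n} {as} → φs at* x ↓ as →
           ⟦ map program φs ⟧* (x ∷ []) (map proj₁ as)
  ↓*⇒⟦⟧* []       = tt
  ↓*⇒⟦⟧* (r ∷ rs) = r , ↓*⇒⟦⟧* rs

  ⟦⟧*⇒↓* : ∀ {x} (φs : Vec D n) {ys} → ⟦ map program φs ⟧* (x ∷ []) ys →
           ∃[ as ] φs at* x ↓ as
  ⟦⟧*⇒↓* []       _ = [] , []
  ⟦⟧*⇒↓* (φ ∷ φs) {y ∷ _} (r , rs) =
    let as , rs′ = ⟦⟧*⇒↓* φs rs in (y , into φ _ y r) ∷ as , r ∷ rs′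

  almost* : (φs : Vec D n) → C ⊆* λ x → ∃[ as ] φs at* x ↓ as
  almost* []       = ⊆*-total λ _ → [] , []
  almost* (φ ∷ φs) =
    ⊆*-weaken (λ { ((y , r) , (as , rs)) → (y , into φ _ y r) ∷ as , r ∷ rs })
              (⊆*-∩ (almost φ) (almost* φs))

  agree* : {φs ψs : Vec D n} → Pointwise _=ᶜ_ φs ψs →
           C ⊆* λ x → ∃[ as ] φs at* x ↓ as × ψs at* x ↓ as
  agree* []       = ⊆*-total λ _ → [] , [] , []
  agree* (e ∷ es) =
    ⊆*-weaken (λ { ((a , r , s) , (as , rs , ss)) → a ∷ as , r ∷ rs , s ∷ ss })
              (⊆*-∩ e (agree* es))

  applyᴾ : ∀ f → Vec D (farity f) → PR 1
  applyᴾ f φs = comp funᴾ (constᴾ (proj₁ f) ∷ tupleᴾ (map program φs) ∷ [])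

  -- The next two lemmas say that applyᴾ f φs computes, up to ≃, the function
  -- x ↦ f (φ₁ x , … , φₙ x).

  applyᴾ-correct : ∀ f φs {x as} → φs at* x ↓ as →
                   ⟦ applyᴾ f φs ⟧ (x ∷ []) (proj₁ (fun f as))
  applyᴾ-correct f φs {x} {as} rs =
    proj₁ f ∷ ⟨ map proj₁ as ⟩ ∷ [] ,
    (constᴾ-correct (proj₁ f) (x ∷ []) ,
     tupleᴾ-correct (map program φs) (↓*⇒⟦⟧* rs) , tt) ,
    funᴾ-correct f as

  applyᴾ-converges : ∀ f φs {x y} → ⟦ applyᴾ f φs ⟧ (x ∷ []) y →
                     ∃[ as ] φs at* x ↓ as × y ≡ proj₁ (fun f as)
  applyᴾ-converges f φs run@(_ ∷ _ ∷ [] , (_ , v , _) , _) =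
    let _  , vs = tupleᴾ-converges (map program φs) v
        as , rs = ⟦⟧*⇒↓* φs vs
    in as , rs , deterministic (applyᴾ f φs) run (applyᴾ-correct f φs rs)

  apply : ∀ f → Vec D (farity f) → D
  apply f φs = record
    { program = applyᴾ f φs
    ; into    = λ x y run → let as , _ , e = applyᴾ-converges f φs run in
                  subst (λ z → T (ComputableSet.char universe z)) (sym e)
                        (proj₂ (fun f as))
    ; almost  = ⊆*-weaken (λ (as , rs) → proj₁ (fun f as) , applyᴾ-correct f φs rs)
                          (almost* φs)
    }

  constant : Dom → D
  constant (c , c∈A) = record
    { program = constᴾ c
    ; into    = λ x y r →
        subst (λ z → T (ComputableSet.char universe z))
              (deterministic (constᴾ c) (constᴾ-correct c (x ∷ [])) r) c∈A
    ; almost  = ⊆*-total λ x → c , constᴾ-correct c (x ∷ [])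
    }

  holds : ∀ P → Vec D (parity P) → Set
  holds P φs = C ⊆* λ x → ∃[ as ] φs at* x ↓ as × T (pred P as)

  ↓*-transfer : ∀ {x} {φs ψs : Vec D n} {as bs} →
                φs at* x ↓ as → φs at* x ↓ bs → ψs at* x ↓ bs → ψs at* x ↓ as
  ↓*-transfer []       []       []       = []
  ↓*-transfer {x = x} {φ ∷ _} {ψ ∷ _} (r ∷ rs) (s ∷ ss) (t ∷ ts) =
    subst (⟦ program ψ ⟧ (x ∷ [])) (deterministic (program φ) s r) t ∷ ↓*-transfer rs ss ts

  power : Structure L
  power = record
    { domain    = D/=ᶜ
    ; fun       = apply
    ; fun-cong  = λ f {φs} {ψs} es →
        ⊆*-weaken (λ (as , rs , ss) →
                     fun f as , applyᴾ-correct f φs rs , applyᴾ-correct f ψs ss)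
                  (agree* es)
    ; pred      = holds
    ; pred-resp = λ P es h →
        ⊆*-weaken (λ { ((as , rs , p) , (_ , ss , ts)) → as , ↓*-transfer rs ss ts , p })
                  (⊆*-∩ h (agree* es))
    ; const     = λ c → constant (const c)
    }

infix 5 Π[_]_

Π[_]_ : ∀ {L} → Pred ℕ 0ℓ → ComputableStructure L → Structure L
Π[ C ] 𝓐 = CohesivePower.power C 𝓐

{-# OPTIONS --safe #-}

-- Let C be the complement of the maximal set M. Both structures consist of
-- coded triples (n , k , s), with the relations E u v, "the first components
-- agree", and R u v, "the first two components agree and v = (n , k , s) is a
-- witness". In 𝓐, (n , k , s) is a witness if n + 1 + k enters M at stage s; in
-- 𝓑, if k is even and s = 0. For each n there are infinitely many k with
-- n + 1 + k ∈ M and infinitely many with n + 1 + k ∉ M, and a number enters M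
-- only once, so 𝓐 ≅ 𝓑, though not computably. The powers differ on the sentence
-- ∀x ∃y (E x y ∧ ∀z ¬ R y z). It holds in Π_C 𝓑 because an odd k is found
-- computably. In Π_C 𝓐, a y for the class of n ↦ (n , 0 , 0) would be a partial
-- computable function that finds, for almost all n ∈ C, an element of C above
-- n. Since C is co-c.e., it extends to a total computable function, and this
-- bounds the gaps of C, contradicting cohesiveness.

module Submission where

open import Defs
open import Axiom.ExcludedMiddle using (ExcludedMiddle)
open import Data.Bool.Base using (Bool; true; false; T)
open import Data.Empty using (⊥-elim; ⊥)
open import Data.Fin.Base using (Fin; zero; suc; _↑ʳ_)
open import Data.List.Base using (_∷_; upTo)
open import Data.List.Membership.Propositional using (_∈_)
open import Data.List.Membership.Propositional.Properties using (∈-upTo⁺)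
open import Data.List.Relation.Unary.Any using (here; there)
open import Data.Nat.Base
open import Data.Nat.ListAction using (sum)
open import Data.Nat.Properties
open import Data.Product using (∃-syntax; Σ-syntax; _×_; _,_; proj₁; proj₂)
open import Data.Product.Function.Dependent.Propositional using (Σ-↔)
open import Data.Sum.Base using (inj₁; inj₂; _⊎_)
open import Data.Unit.Base using (tt)
open import Data.Vec.Base using (Vec; []; _∷_; _++_; lookup; map; tabulate)
open import Data.Vec.Properties using (map-++; tabulate-∘; tabulate∘lookup; ∷-injective)
open import Data.Vec.Relation.Binary.Pointwise.Inductive using ([]; _∷_)
open import Function.Base using (_∘_)
open import Function.Bundles using (_↔_; _⇔_; mk⇔; mk↔ₛ′; mk⤖; Inverse; Equivalence; Bijection)
open import Function.Construct.Composition using (_↔-∘_)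
open import Function.Construct.Identity using (↔-id)
open import Function.Construct.Symmetry using (↔-sym)
open import Function.Properties.Bijection using (⤖⇒↔)
open import Function.Properties.Inverse using (↔⇒⤖)
open import Level using (0ℓ)
open import Relation.Binary.Bundles using (Setoid)
open import Relation.Binary.Definitions using (tri<; tri≈; tri>)
open import Relation.Binary.PropositionalEquality
open import Relation.Nullary using (¬_; yes; no; Dec; ¬?)
open import Relation.Nullary.Decidable using (decidable-stable)
open import Relation.Unary using (Pred; _∩_; ∁; Decidable; _≐_)

private
  variable
    k m n : ℕ

-- Total computable functions, as programs with their values.

record Total (n : ℕ) : Set where
  constructor total
  field
    code    : PR n
    value   : Vec ℕ n → ℕ
    correct : ∀ xs → ⟦ code ⟧ xs (value xs)

open Total

values : Vec (Total n) m → Vec ℕ n → Vec ℕ m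
values gs xs = map (λ g → value g xs) gs

codes-correct : (gs : Vec (Total n) m) → ∀ xs → ⟦ map code gs ⟧* xs (values gs xs)
codes-correct []       xs = tt
codes-correct (g ∷ gs) xs = correct g xs , codes-correct gs xs

infixr 9 _∘ᵀ_

_∘ᵀ_ : Total m → Vec (Total n) m → Total n
f ∘ᵀ gs = total (comp (code f) (map code gs)) (λ xs → value f (values gs xs))
  λ xs → values gs xs , codes-correct gs xs , correct f (values gs xs)

-- Keeps the program and changes only the function it is said to compute, so that later goals
-- mention, say, `x ∸ y` in place of an unfolded `primrec`.
recast : (t : Total n) (f : Vec ℕ n → ℕ) → (∀ xs → value t xs ≡ f xs) → Total n
recast t f e = total (code t) f λ xs → subst (⟦ code t ⟧ xs) (e xs) (correct t xs)

var : Fin n → Total n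
var i = total (proj i) (λ xs → lookup xs i) λ _ → refl

const : ℕ → Total n
const c = total (constᴾ c) (λ _ → c) (constᴾ-correct c)

primrec : (Vec ℕ n → ℕ) → (Vec ℕ (suc (suc n)) → ℕ) → Vec ℕ (suc n) → ℕ
primrec f g (zero  ∷ xs) = f xs
primrec f g (suc i ∷ xs) = g (i ∷ primrec f g (i ∷ xs) ∷ xs)

recᵀ : Total n → Total (suc (suc n)) → Total (suc n)
recᵀ f g = total (prec (code f) (code g)) (primrec (value f) (value g)) λ { (i ∷ xs) → go i xs }
  where
  go : ∀ i xs → Prec ⟦ code f ⟧ ⟦ code g ⟧ i xs (primrec (value f) (value g) (i ∷ xs))
  go zero    xs = correct f xs
  go (suc i) xs = _ , go i xs , correct g _


rest : ∀ k → Vec ℕ (k + n) → Vec ℕ n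
rest zero    xs       = xs
rest (suc k) (_ ∷ xs) = rest k xs

rest-lookup : ∀ k (xs : Vec ℕ (k + n)) → tabulate (λ i → lookup xs (k ↑ʳ i)) ≡ rest k xs
rest-lookup zero    xs       = tabulate∘lookup xs
rest-lookup (suc k) (_ ∷ xs) = rest-lookup k xs

values-++ : (gs : Vec (Total n) m) (hs : Vec (Total n) k) → ∀ xs →
            values (gs ++ hs) xs ≡ values gs xs ++ values hs xs
values-++ gs hs xs = map-++ (λ g → value g xs) gs hs

-- The context consists of `k` local variables followed by `n` parameters. The terms `gs` fill the
-- first `m` arguments of `f`, and the parameters are handed on unchanged. With `rest` in the
-- specification, the value reduces on `x ∷ xs` even though `n` is arbitrary.
plug : ∀ k → Total (m + n) → Vec (Total (k + n)) m → Total (k + n)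
plug {m} {n} k f gs = recast (f ∘ᵀ (gs ++ vars)) (λ xs → value f (values gs xs ++ rest k xs))
  λ xs → cong (value f) (trans (values-++ gs vars xs) (cong (values gs xs ++_)
    (trans (sym (tabulate-∘ (λ g → value g xs) _)) (rest-lookup k xs))))
  where
  vars : Vec (Total (k + n)) n
  vars = tabulate λ i → var (k ↑ʳ i)

v0 : Total (suc n)
v0 = var zero

v1 : Total (suc (suc n))
v1 = var (suc zero)

v2 : Total (suc (suc (suc n)))
v2 = var (suc (suc zero))

v3 : Total (suc (suc (suc (suc n))))
v3 = var (suc (suc (suc zero)))

sucᵀ : Total n → Total n
sucᵀ t = total S (λ { (x ∷ []) → suc x }) (λ { (x ∷ []) → refl }) ∘ᵀ (t ∷ [])

predᵀ : Total n → Total n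
predᵀ t = recast (recᵀ (const 0) v0) (λ { (x ∷ []) → pred x })
  (λ { (zero ∷ []) → refl ; (suc x ∷ []) → refl }) ∘ᵀ (t ∷ [])

infixl 6 _+ᵀ_ _∸ᵀ_

_+ᵀ_ : Total n → Total n → Total n
s +ᵀ t = total addᴾ (λ { (x ∷ y ∷ []) → x + y }) (λ { (x ∷ y ∷ []) → addᴾ-correct x y })
  ∘ᵀ (s ∷ t ∷ [])

_∸ᵀ_ : Total n → Total n → Total n
s ∸ᵀ t = recast (recᵀ v0 (predᵀ v1)) (λ { (y ∷ x ∷ []) → x ∸ y })
  (λ { (y ∷ x ∷ []) → go y x }) ∘ᵀ (t ∷ s ∷ [])
  where
  go : ∀ y x → value (recᵀ v0 (predᵀ v1)) (y ∷ x ∷ []) ≡ x ∸ y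
  go zero    x = refl
  go (suc y) x = trans (cong pred (go y x)) (pred[m∸n]≡m∸[1+n] x y)

ifZero : ℕ → ℕ → ℕ → ℕ
ifZero zero    x y = x
ifZero (suc _) x y = y

ifZeroᵀ : Total n → Total n → Total n → Total n
ifZeroᵀ c s t = recast (recᵀ v0 v3) (λ { (c ∷ x ∷ y ∷ []) → ifZero c x y })
  (λ { (zero ∷ x ∷ y ∷ []) → refl ; (suc c ∷ x ∷ y ∷ []) → refl }) ∘ᵀ (c ∷ s ∷ t ∷ [])

-- Evaluation with fuel

-- eval p (s ∷ xs) is suc y if fuel s suffices to compute the output y of p on
-- xs, and 0 otherwise.

predsᵀ : Vec (Total n) m → Vec (Total n) m
predsᵀ = map predᵀ

-- Makes composition strict: an unfinished argument has value 0, and `predsᵀ` alone would pass it on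
-- as if it were an output 0.
guards : Vec (Total n) m → Total n → Total n
guards []       e = e
guards (t ∷ ts) e = ifZeroᵀ t (const 0) (guards ts e)

evalPrec : Total (suc n) → Total (suc (suc (suc n))) → Total (suc (suc n))
evalPrec f g = recᵀ f (ifZeroᵀ v1 (const 0) (plug 3 g (v2 ∷ v0 ∷ predᵀ v1 ∷ [])))

-- The states of the search for a zero of f: 0 while it goes on, 1 if it failed
-- because a computation did not end, and suc (suc y) if it ended with y.

evalSearch : Total (suc (suc n)) → Total (suc (suc n))
evalSearch f = recᵀ (const 0)
  (ifZeroᵀ v1
    (ifZeroᵀ r (const 1) (ifZeroᵀ (predᵀ r) (sucᵀ (sucᵀ v0)) (const 0)))
    v1)
  where r = plug 3 f (v2 ∷ v0 ∷ [])

eval  : PR n → Total (suc n)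
eval* : Vec (PR n) m → Vec (Total (suc n)) m

eval Z           = const 1
eval S           = sucᵀ (sucᵀ v1)
eval (proj i)    = sucᵀ (var (suc i))
eval (comp f gs) = guards (eval* gs) (eval f ∘ᵀ (v0 ∷ predsᵀ (eval* gs)))
-- `recᵀ` recurses on its first argument, so counter and fuel change places.
eval (prec f g)  = plug 2 (evalPrec (eval f) (eval g)) (v1 ∷ v0 ∷ [])
-- The fuel also limits the number of candidates tried. `predᵀ` sends both unsuccessful states, 0
-- and 1, to 0, and `suc (suc y)` to `suc y`.
eval (mu f)      = predᵀ (plug 1 (evalSearch (eval f)) (v0 ∷ v0 ∷ []))

eval* []       = []
eval* (g ∷ gs) = eval g ∷ eval* gs

guards-suc⁻ : (ts : Vec (Total n) m) (e : Total n) → ∀ {xs y} →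
              value (guards ts e) xs ≡ suc y →
              ∃[ zs ] values ts xs ≡ map suc zs × value e xs ≡ suc y
guards-suc⁻ []       e eq = [] , refl , eq
guards-suc⁻ (t ∷ ts) e {xs} eq with value t xs
... | suc z = let zs , eqs , eq′ = guards-suc⁻ ts e eq in z ∷ zs , cong (suc z ∷_) eqs , eq′

guards-suc⁺ : (ts : Vec (Total n) m) (e : Total n) → ∀ {xs zs} →
              values ts xs ≡ map suc zs → value (guards ts e) xs ≡ value e xs
guards-suc⁺ []       e eqs = refl
guards-suc⁺ (t ∷ ts) e {xs} {z ∷ zs} eqs with value t xs | ∷-injective eqs
... | _ | refl , eqs′ = guards-suc⁺ ts e eqs′

values-predsᵀ : (ts : Vec (Total n) m) → ∀ {xs zs} →
                values ts xs ≡ map suc zs → values (predsᵀ ts) xs ≡ zs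
values-predsᵀ []       {zs = []}     eqs = refl
values-predsᵀ (t ∷ ts) {zs = z ∷ zs} eqs =
  let eq , eqs′ = ∷-injective eqs in cong₂ _∷_ (cong pred eq) (values-predsᵀ ts eqs′)

module Search (f : Total (suc (suc n))) (s : ℕ) (xs : Vec ℕ n) where

  state : ℕ → ℕ
  state b = value (evalSearch f) (b ∷ s ∷ xs)

  output : ℕ → ℕ
  output z = value f (s ∷ z ∷ xs)

  Positive : ℕ → Set
  Positive z = ∃[ r ] output z ≡ suc (suc r)

  state-searching : ∀ b → state b ≡ 0 → ∀ z → z < b → Positive z
  state-searching (suc b) eq z z<1+b with state b | state-searching b | output b in eqb
  ... | zero | ih | suc (suc r) with m≤n⇒m<n∨m≡n (s≤s⁻¹ z<1+b)
  ...   | inj₁ z<b  = ih refl z z<b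
  ...   | inj₂ refl = r , eqb

  state-found : ∀ b {y} → state b ≡ suc (suc y) → output y ≡ 1 × (∀ z → z < y → Positive z)
  state-found (suc b) eq with state b | state-searching b | state-found b | output b in eqb
  ... | zero  | ih₀ | ih | 1 with refl ← eq = eqb , ih₀ refl
  ... | suc _ | ih₀ | ih | _ = ih eq

  searching : ∀ b → (∀ z → z < b → Positive z) → state b ≡ 0
  searching zero    pos = refl
  searching (suc b) pos with state b | searching b (λ z z<b → pos z (m<n⇒m<1+n z<b))
                           | output b | pos b (n<1+n b)
  ... | _ | refl | _ | _ , refl = refl

  found : ∀ b {y} → y < b → output y ≡ 1 → (∀ z → z < y → Positive z) → state b ≡ suc (suc y)
  found (suc b) {y} y<1+b eq pos with m≤n⇒m<n∨m≡n (s≤s⁻¹ y<1+b)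
  ... | inj₁ y<b with state b | found b y<b eq pos
  ...   | _ | refl = refl
  found (suc b) y<1+b eq pos | inj₂ refl with state b | searching b pos | output b | eq
  ... | _ | refl | _ | refl = refl

eval-sound  : (p : PR n) → ∀ s xs {y} → value (eval p) (s ∷ xs) ≡ suc y → ⟦ p ⟧ xs y
eval*-sound : (ps : Vec (PR n) m) → ∀ s xs {ys} →
              values (eval* ps) (s ∷ xs) ≡ map suc ys → ⟦ ps ⟧* xs ys

eval-sound Z        s xs       refl = refl
eval-sound S        s (x ∷ []) refl = refl
eval-sound (proj i) s xs       refl = refl
eval-sound (comp f gs) s xs eq =
  let zs , eqs , eq′ = guards-suc⁻ (eval* gs) _ eq
  in zs , eval*-sound gs s xs eqs ,
     eval-sound f s zs (subst (λ us → value (eval f) (s ∷ us) ≡ _)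
       (values-predsᵀ (eval* gs) eqs) eq′)
eval-sound (prec f g) s (i ∷ xs) = go i
  where
  go : ∀ i {y} → value (evalPrec (eval f) (eval g)) (i ∷ s ∷ xs) ≡ suc y →
       Prec ⟦ f ⟧ ⟦ g ⟧ i xs y
  go zero    eq = eval-sound f s xs eq
  go (suc i) eq with value (evalPrec (eval f) (eval g)) (i ∷ s ∷ xs) | go i
  ... | suc r | ih = r , ih refl , eval-sound g s (i ∷ r ∷ xs) eq
eval-sound (mu f) s xs {y} eq =
  let open Search (eval f) s xs
      out , pos = state-found s {y} (pred-suc eq)
  in eval-sound f s (y ∷ xs) out ,
     λ z z<y → let r , eqz = pos z z<y in r , eval-sound f s (z ∷ xs) eqz
  where
  pred-suc : ∀ {m n} → pred m ≡ suc n → m ≡ suc (suc n)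
  pred-suc {suc m} eq = cong suc eq

eval*-sound []       s xs {[]}     eqs = tt
eval*-sound (p ∷ ps) s xs {y ∷ ys} eqs =
  let eq , eqs′ = ∷-injective eqs in eval-sound p s xs eq , eval*-sound ps s xs eqs′

-- Asking for all large fuels, and not just for one, lets finitely many subcomputations share a fuel
-- by taking a maximum.
Eventually : (ℕ → Set) → Set
Eventually P = ∃[ b ] ∀ s → b ≤ s → P s

eventually-× : ∀ {P Q : ℕ → Set} → Eventually P → Eventually Q → Eventually (λ s → P s × Q s)
eventually-× (b , p) (c , q) =
  b ⊔ c , λ s b⊔c≤s → p s (m⊔n≤o⇒m≤o b c b⊔c≤s) , q s (m⊔n≤o⇒n≤o b c b⊔c≤s)

eventually-map : ∀ {P Q : ℕ → Set} → (∀ {s} → P s → Q s) → Eventually P → Eventually Q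
eventually-map f (b , p) = b , λ s b≤s → f (p s b≤s)

eventually-below : ∀ {P : ℕ → ℕ → Set} y → (∀ z → z < y → Eventually (P z)) →
                   Eventually (λ s → ∀ z → z < y → P z s)
eventually-below zero    e = 0 , λ _ _ _ ()
eventually-below {P} (suc y) e = eventually-map join
  (eventually-× (eventually-below y λ z z<y → e z (m<n⇒m<1+n z<y)) (e y (n<1+n y)))
  where
  join : ∀ {s} → (∀ z → z < y → P z s) × P y s → ∀ z → z < suc y → P z s
  join (below , at) z z<1+y with m≤n⇒m<n∨m≡n (s≤s⁻¹ z<1+y)
  ... | inj₁ z<y  = below z z<y
  ... | inj₂ refl = at

eval-complete  : (p : PR n) → ∀ xs {y} → ⟦ p ⟧ xs y →
                 Eventually λ s → value (eval p) (s ∷ xs) ≡ suc y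
eval*-complete : (ps : Vec (PR n) m) → ∀ xs {ys} → ⟦ ps ⟧* xs ys →
                 Eventually λ s → values (eval* ps) (s ∷ xs) ≡ map suc ys

eval-complete Z        xs       refl = 0 , λ _ _ → refl
eval-complete S        (x ∷ []) refl = 0 , λ _ _ → refl
eval-complete (proj i) xs       refl = 0 , λ _ _ → refl
eval-complete (comp f gs) xs (zs , us , v) =
  eventually-map
    (λ {s} (eqs , eq) → trans (guards-suc⁺ (eval* gs) _ eqs)
      (subst (λ us → value (eval f) (s ∷ us) ≡ _) (sym (values-predsᵀ (eval* gs) eqs)) eq))
    (eventually-× (eval*-complete gs xs us) (eval-complete f zs v))
eval-complete (prec f g) (i ∷ xs) = go i
  where
  go : ∀ i {y} → Prec ⟦ f ⟧ ⟦ g ⟧ i xs y →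
       Eventually λ s → value (evalPrec (eval f) (eval g)) (i ∷ s ∷ xs) ≡ suc y
  go zero    u = eval-complete f xs u
  go (suc i) (r , u , v) =
    eventually-map
      (λ {s} (eq , eq′) → trans
        (cong (λ c → ifZero c 0 (value (eval g) (s ∷ i ∷ pred c ∷ xs))) eq) eq′)
      (eventually-× (go i u) (eval-complete g (i ∷ r ∷ xs) v))
eval-complete (mu f) xs {y} (u , v) =
  eventually-map
    (λ {s} (y<s , out , pos) → cong pred (Search.found (eval f) s xs s y<s out pos))
    -- Fuel `s` tests only the candidates below `s`, so it must exceed `y`.
    (eventually-× (suc y , λ s y<s → y<s)
      (eventually-× (eval-complete f (y ∷ xs) u)
        (eventually-below y λ z z<y →
          eventually-map (λ eq → proj₁ (v z z<y) , eq)
            (eval-complete f (z ∷ xs) (proj₂ (v z z<y))))))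

eval*-complete []       xs {[]}     _        = 0 , λ _ _ → refl
eval*-complete (p ∷ ps) xs {y ∷ ys} (u , us) =
  eventually-map (λ (eq , eqs) → cong₂ _∷_ eq eqs)
    (eventually-× (eval-complete p xs u) (eval*-complete ps xs us))

m+n≡0 : ∀ {a b} → a ≡ 0 → b ≡ 0 → a + b ≡ 0
m+n≡0 = cong₂ _+_

-- Inverses of the pairing function

triangular-mono : ∀ {x y} → x ≤ y → triangular x ≤ triangular y
triangular-mono z≤n       = z≤n
triangular-mono (s≤s x≤y) = s≤s (+-mono-≤ x≤y (triangular-mono x≤y))

-- The index of the diagonal on which `z` lies in Cantor's enumeration, that is, the largest `r`
-- with `triangular r ≤ z`. Passing from `z` to `suc z` either stays on the diagonal or begins the
-- next one.
row : ℕ → ℕ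
row zero    = 0
row (suc z) = ifZero (triangular (suc (row z)) ∸ suc z) (suc (row z)) (row z)

row-bounds : ∀ z → triangular (row z) ≤ z × z < triangular (suc (row z))
row-bounds zero    = z≤n , s≤s z≤n
row-bounds (suc z) with row z | row-bounds z
... | r | lo , hi with triangular (suc r) ∸ suc z in eq
...   | zero  = m∸n≡0⇒m≤n eq , s≤s (≤-trans hi (m≤n+m _ (suc r)))
...   | suc d = m≤n⇒m≤1+n lo , m∸n≡suc⇒n<m eq
  where
  m∸n≡suc⇒n<m : ∀ {a b d} → a ∸ b ≡ suc d → b < a
  m∸n≡suc⇒n<m {a} {b} e = m∸n≢0⇒n<m λ e′ → 0≢1+n (trans (sym e′) e)

row-unique : ∀ {w z} → triangular w ≤ z → z < triangular (suc w) → row z ≡ w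
row-unique {w} {z} lo hi with row-bounds z
... | lo′ , hi′ = ≤-antisym
  (≮⇒≥ λ w<r → <⇒≱ hi (≤-trans (triangular-mono w<r) lo′))
  (≮⇒≥ λ r<w → <⇒≱ hi′ (≤-trans (triangular-mono r<w) lo))

opaque

  fst snd : ℕ → ℕ
  snd z = z ∸ triangular (row z)
  fst z = row z ∸ snd z

  snd≤row : ∀ z → snd z ≤ row z
  snd≤row z = m≤n+o⇒m∸n≤o z (triangular (row z))
    (subst (z ≤_) (+-comm (row z) _) (s≤s⁻¹ (proj₂ (row-bounds z))))

  pair-fst-snd : ∀ z → pair (fst z) (snd z) ≡ z
  pair-fst-snd z = trans (cong (λ w → triangular w + snd z) (m∸n+n≡m (snd≤row z)))
    (m+[n∸m]≡n (proj₁ (row-bounds z)))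

  row-pair : ∀ x y → row (pair x y) ≡ x + y
  row-pair x y = row-unique (m≤m+n _ y)
    (s≤s (subst (pair x y ≤_) (+-comm _ (x + y)) (+-monoʳ-≤ _ (m≤n+m y x))))

  snd-pair : ∀ x y → snd (pair x y) ≡ y
  snd-pair x y rewrite row-pair x y = m+n∸m≡n (triangular (x + y)) y

  fst-pair : ∀ x y → fst (pair x y) ≡ x
  fst-pair x y rewrite snd-pair x y | row-pair x y = m+n∸n≡m x y

  -- Outside the opaque block `fst` and `snd` do not unfold; these equations are what connects them
  -- to their programs.
  fst-snd-def : ∀ z → row z ∸ (z ∸ triangular (row z)) ≡ fst z × z ∸ triangular (row z) ≡ snd z
  fst-snd-def z = refl , refl

pairᵀ : Total n → Total n → Total n
pairᵀ s t = total pairᴾ (λ { (x ∷ y ∷ []) → pair x y }) (λ { (x ∷ y ∷ []) → pairᴾ-correct x y })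
  ∘ᵀ (s ∷ t ∷ [])

triangularᵀ : Total n → Total n
triangularᵀ t = total triangularᴾ (λ { (x ∷ []) → triangular x })
  (λ { (x ∷ []) → triangularᴾ-correct x }) ∘ᵀ (t ∷ [])

rowᵀ : Total n → Total n
rowᵀ t = recast rows (λ { (z ∷ []) → row z }) (λ { (z ∷ []) → go z }) ∘ᵀ (t ∷ [])
  where
  rows : Total 1
  rows = recᵀ (const 0) (ifZeroᵀ (triangularᵀ (sucᵀ v1) ∸ᵀ sucᵀ v0) (sucᵀ v1) v1)
  go : ∀ z → value rows (z ∷ []) ≡ row z
  go zero    = refl
  go (suc z) = cong (λ r → ifZero (triangular (suc r) ∸ suc z) (suc r) r) (go z)

fstᵀ sndᵀ : Total n → Total n
fstᵀ t = recast (rowᵀ v0 ∸ᵀ (v0 ∸ᵀ triangularᵀ (rowᵀ v0))) (λ { (z ∷ []) → fst z })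
  (λ { (z ∷ []) → proj₁ (fst-snd-def z) }) ∘ᵀ (t ∷ [])
sndᵀ t = recast (v0 ∸ᵀ triangularᵀ (rowᵀ v0)) (λ { (z ∷ []) → snd z })
  (λ { (z ∷ []) → proj₂ (fst-snd-def z) }) ∘ᵀ (t ∷ [])

-- Unbounded search

least : ∀ (f : ℕ → ℕ) y → f y ≡ 0 → ∃[ z ] f z ≡ 0 × (∀ w → w < z → ∃[ r ] f w ≡ suc r)
least f y eq with f 0 in eq₀
... | zero = 0 , eq₀ , λ _ ()
least f zero    eq | suc r = ⊥-elim (0≢1+n (trans (sym eq) eq₀))
least f (suc y) eq | suc r =
  let z , eq′ , below = least (f ∘ suc) y eq
  in suc z , eq′ , λ { zero _ → r , eq₀ ; (suc w) w<z → below w (s≤s⁻¹ w<z) }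

mu-converges : (t : Total (suc n)) → ∀ {y} xs → value t (y ∷ xs) ≡ 0 →
               ∃[ z ] ⟦ mu (code t) ⟧ xs z × value t (z ∷ xs) ≡ 0
mu-converges t {y} xs eq =
  let z , eq′ , below = least (λ w → value t (w ∷ xs)) y eq
  in z , (subst (⟦ code t ⟧ _) eq′ (correct t _) ,
          λ w w<z → let r , eqw = below w w<z in r , subst (⟦ code t ⟧ _) eqw (correct t _)) ,
     eq′

mu-zero : (t : Total (suc n)) → ∀ {y} xs → ⟦ mu (code t) ⟧ xs y → value t (y ∷ xs) ≡ 0
mu-zero t xs (u , _) = deterministic (code t) (correct t _) u

-- The existence proof `e` only ensures that the search ends; the program does not depend on it.
-- Hence `e` may use excluded middle and the result is still computable.
searchᵀ : (t : Total (suc n)) → (∀ xs → ∃[ y ] value t (y ∷ xs) ≡ 0) → Total n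
searchᵀ t e = total (mu (code t)) (λ xs → proj₁ (run xs)) λ xs → proj₁ (proj₂ (run xs))
  where
  run : ∀ xs → ∃[ z ] ⟦ mu (code t) ⟧ xs z × value t (z ∷ xs) ≡ 0
  run xs = mu-converges t xs (proj₂ (e xs))

searchᵀ-zero : (t : Total (suc n)) (e : ∀ xs → ∃[ y ] value t (y ∷ xs) ≡ 0) → ∀ xs →
               value t (value (searchᵀ t e) xs ∷ xs) ≡ 0
searchᵀ-zero t e xs = mu-zero t xs (correct (searchᵀ t e) xs)

∃-CE : (t : Total 2) → CE λ x → ∃[ i ] value t (i ∷ x ∷ []) ≡ 0
∃-CE t = mu (code t) ,
  (λ {x} (i , eq) → let z , u , _ = mu-converges t (x ∷ []) eq in z , u) ,
  (λ {x} (z , u) → z , mu-zero t (x ∷ []) u)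

-- Finite sets and cohesiveness

Unbounded : Pred ℕ 0ℓ → Set
Unbounded X = ∀ b → ∃[ x ] b ≤ x × X x

∈⇒≤sum : ∀ {x l} → x ∈ l → x ≤ sum l
∈⇒≤sum (here refl)      = m≤m+n _ _
∈⇒≤sum {l = y ∷ l} (there x∈l) = ≤-trans (∈⇒≤sum x∈l) (m≤n+m _ y)

unbounded⇒infinite : ∀ {X} → Unbounded X → ¬ Finite X
unbounded⇒infinite unb (l , X⊆l) =
  let x , b≤x , x∈X = unb (suc (sum l)) in <⇒≱ b≤x (∈⇒≤sum (X⊆l x∈X))

module Classical (em : ExcludedMiddle 0ℓ) where

  infinite⇒unbounded : ∀ {X} → ¬ Finite X → Unbounded X
  infinite⇒unbounded {X} inf b with em {∃[ x ] b ≤ x × X x}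
  ... | yes found = found
  ... | no ¬found = ⊥-elim (inf (upTo b , λ {x} x∈X → ∈-upTo⁺ (≰⇒> λ b≤x → ¬found (x , b≤x , x∈X))))

  ⊆*⇒eventually : ∀ {X Y} → X ⊆* Y → Eventually λ x → X x → Y x
  ⊆*⇒eventually {X} {Y} (l , h) = suc (sum l) , λ x b≤x x∈X → lemma x b≤x x∈X em
    where
    lemma : ∀ x → sum l < x → X x → Dec (Y x) → Y x
    lemma x b≤x x∈X (yes x∈Y) = x∈Y
    lemma x b≤x x∈X (no x∉Y)  = ⊥-elim (<⇒≱ b≤x (∈⇒≤sum (h (x∈X , x∉Y))))

eventually⇒⊆* : ∀ {X Y : Pred ℕ 0ℓ} → (Eventually λ x → X x → Y x) → X ⊆* Y
eventually⇒⊆* (b , h) = upTo b , λ {x} (x∈X , x∉Y) → ∈-upTo⁺ (≰⇒> λ b≤x → x∉Y (h x b≤x x∈X))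

-- If the gaps of C are bounded by a computable function, they cut off blocks
-- [aᵢ , aᵢ₊₁) that all meet C; the union of the blocks with even index then
-- splits C into two infinite pieces.

module Blocks (em : ExcludedMiddle 0ℓ) {C : Pred ℕ 0ℓ} (cohesive : Cohesive C)
              (g : Total 1) (b : ℕ)
              (next : ∀ n → b ≤ n → C n → ∃[ m ] C m × n < m × m ≤ value g (n ∷ [])) where

  open Classical em

  start : ∃[ c ] b ≤ c × C c
  start = infinite⇒unbounded (proj₁ cohesive) b

  -- `g` is not assumed monotone. Adding up its values gives a function that exceeds both `x` and
  -- every `g m` with `m < x`, which matters because the last element of `C` in a block may be any
  -- point of it.
  boundᵀ : Total 1
  boundᵀ = recᵀ (const 1) (sucᵀ (v1 +ᵀ (g ∘ᵀ (v0 ∷ []))))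

  bound : ℕ → ℕ
  bound x = value boundᵀ (x ∷ [])

  bound-> : ∀ x → x < bound x
  bound-> zero    = s≤s z≤n
  bound-> (suc x) = s≤s (≤-trans (bound-> x) (m≤m+n _ _))

  g<bound : ∀ {m} x → m < x → value g (m ∷ []) < bound x
  g<bound (suc x) m<1+x with m≤n⇒m<n∨m≡n (s≤s⁻¹ m<1+x)
  ... | inj₁ m<x  = m<n⇒m<1+n (≤-trans (g<bound x m<x) (m≤m+n _ _))
  ... | inj₂ refl = s≤s (m≤n+m _ (bound x))

  endᵀ : Total 1
  endᵀ = recᵀ (const (proj₁ start)) (boundᵀ ∘ᵀ (v1 ∷ []))

  end : ℕ → ℕ
  end i = value endᵀ (i ∷ [])

  end-mono : ∀ {i j} → i ≤ j → end i ≤ end j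
  end-mono {j = zero}  z≤n = ≤-refl
  end-mono {j = suc j} i≤1+j with m≤n⇒m<n∨m≡n i≤1+j
  ... | inj₁ i≤j  = ≤-trans (end-mono (s≤s⁻¹ i≤j)) (<⇒≤ (bound-> (end j)))
  ... | inj₂ refl = ≤-refl

  i≤end : ∀ i → i ≤ end i
  i≤end zero    = z≤n
  i≤end (suc i) = ≤-<-trans (i≤end i) (bound-> (end i))

  InBlock : ℕ → ℕ → Set
  InBlock i x = end i ≤ x × x < end (suc i)

  -- Follows `next` from `c` until the block is left; `d` bounds the number of steps, as each moves
  -- up by at least one. The first element outside is at most `g c` for some `c` below
  -- `end (suc i)`, so it cannot jump over the next block.
  leave : ∀ i d c → C c → b ≤ c → InBlock i c → end (suc i) ≤ d + c →
          ∃[ c′ ] C c′ × b ≤ c′ × InBlock (suc i) c′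
  leave i zero    c _   _   (_ , hi)  e≤c = ⊥-elim (<⇒≱ hi e≤c)
  leave i (suc d) c c∈C b≤c (lo , hi) e≤1+d+c with next c b≤c c∈C
  ... | c′ , c′∈C , c<c′ , c′≤g with c′ <? end (suc i)
  ...   | yes c′<e = leave i d c′ c′∈C (≤-trans b≤c (<⇒≤ c<c′)) (≤-trans lo (<⇒≤ c<c′) , c′<e)
                       (≤-trans e≤1+d+c (subst (_≤ d + c′) (+-suc d c) (+-monoʳ-≤ d c<c′)))
  ...   | no c′≮e  = c′ , c′∈C , ≤-trans b≤c (<⇒≤ c<c′) ,
                     ≮⇒≥ c′≮e , ≤-<-trans c′≤g (g<bound (end (suc i)) hi)

  block-meets-C : ∀ i → ∃[ c ] C c × b ≤ c × InBlock i c
  block-meets-C zero    = let c , b≤c , c∈C = start in c , c∈C , b≤c , ≤-refl , bound-> c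
  block-meets-C (suc i) = let c , c∈C , b≤c , c∈B = block-meets-C i in
    leave i (end (suc i)) c c∈C b≤c c∈B (m≤m+n _ c)

  block-unique : ∀ {i j x} → InBlock i x → InBlock j x → i ≤ j
  block-unique (lo , _) (_ , hi) = ≮⇒≥ λ j<i → <⇒≱ hi (≤-trans (end-mono j<i) lo)

  -- Conditions are encoded as zeros of total functions: a truncated difference vanishes when an
  -- inequality holds, and a sum is a conjunction. Here they say that the second argument lies in
  -- the block with twice the first as index.
  evenᵀ : Total 2
  evenᵀ = (endᵀ ∘ᵀ (v0 +ᵀ v0 ∷ []) ∸ᵀ v1) +ᵀ (sucᵀ v1 ∸ᵀ endᵀ ∘ᵀ (sucᵀ (v0 +ᵀ v0) ∷ []))

  Even : Pred ℕ 0ℓ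
  Even x = ∃[ i ] value evenᵀ (i ∷ x ∷ []) ≡ 0

  even⁺ : ∀ i {x} → InBlock (i + i) x → Even x
  even⁺ i (lo , hi) = i , m+n≡0 (m≤n⇒m∸n≡0 lo) (m≤n⇒m∸n≡0 hi)

  even⁻ : ∀ {x} → Even x → ∃[ i ] InBlock (i + i) x
  even⁻ {x} (i , eq) =
    i , m∸n≡0⇒m≤n (m+n≡0⇒m≡0 (end (i + i) ∸ x) eq) , m∸n≡0⇒m≤n (m+n≡0⇒n≡0 (end (i + i) ∸ x) eq)

  2i≢1+2j : ∀ i j → i + i ≢ suc (j + j)
  2i≢1+2j (suc i) zero    e rewrite +-suc i i = 0≢1+n (sym (suc-injective e))
  2i≢1+2j (suc i) (suc j) e rewrite +-suc i i | +-suc j j =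
    2i≢1+2j i j (suc-injective (suc-injective e))

  odd⇒¬even : ∀ i {x} → InBlock (suc (i + i)) x → ¬ Even x
  odd⇒¬even i x∈B x∈E = let j , x∈B′ = even⁻ x∈E in
    2i≢1+2j j i (≤-antisym (block-unique x∈B′ x∈B) (block-unique x∈B x∈B′))

  even-unbounded : Unbounded (Even ∩ C)
  even-unbounded i = let c , c∈C , _ , c∈B = block-meets-C (i + i) in
    c , ≤-trans (m≤m+n i i) (≤-trans (i≤end (i + i)) (proj₁ c∈B)) , even⁺ i c∈B , c∈C

  odd-unbounded : Unbounded (∁ Even ∩ C)
  odd-unbounded i = let c , c∈C , _ , c∈B = block-meets-C (suc (i + i)) in
    c , ≤-trans (m≤m+n i i) (≤-trans (n≤1+n _) (≤-trans (i≤end (suc (i + i))) (proj₁ c∈B))) ,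
    odd⇒¬even i c∈B , c∈C

  contradiction : ⊥
  contradiction with proj₂ cohesive Even (∃-CE evenᵀ)
  ... | inj₁ fin = unbounded⇒infinite even-unbounded fin
  ... | inj₂ fin = unbounded⇒infinite odd-unbounded fin

open Inverse using (to; from; strictlyInverseˡ; strictlyInverseʳ)

-- Permutations of ℕ

parityBit : ℕ → ℕ
parityBit zero    = 0
parityBit (suc x) = 1 ∸ parityBit x

parityBit-even : ∀ i → parityBit (i + i) ≡ 0
parityBit-even zero = refl
parityBit-even (suc i) rewrite +-suc i i | parityBit-even i = refl

parityBit-odd : ∀ i → parityBit (suc (i + i)) ≡ 1
parityBit-odd i rewrite parityBit-even i = refl

halve : ∀ x → ∃[ i ] (x ≡ i + i ⊎ x ≡ suc (i + i))
halve zero    = 0 , inj₁ refl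
halve (suc x) with halve x
... | i , inj₁ eq = i , inj₂ (cong suc eq)
... | i , inj₂ eq = suc i , inj₁ (trans (cong suc eq) (cong suc (sym (+-suc i i))))

double-injective : ∀ {i j} → i + i ≡ j + j → i ≡ j
double-injective {i} {j} eq with <-cmp i j
... | tri< i<j _ _ = ⊥-elim (<⇒≢ (+-mono-< i<j i<j) eq)
... | tri≈ _ i≡j _ = i≡j
... | tri> _ _ j<i = ⊥-elim (<⇒≢ (+-mono-< j<i j<i) (sym eq))

module Count {U : Pred ℕ 0ℓ} (U? : Decidable U) where

  -- On `U` this is the rank of an element within `U`, hence a bijection from `U` to the natural
  -- numbers when `U` is unbounded.
  count : ℕ → ℕ
  count zero    = 0
  count (suc x) with U? x
  ... | yes _ = suc (count x)
  ... | no _  = count x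

  count-yes : ∀ {x} → U x → count (suc x) ≡ suc (count x)
  count-yes {x} x∈U with U? x
  ... | yes _  = refl
  ... | no x∉U = ⊥-elim (x∉U x∈U)

  count-suc : ∀ x → count x ≤ count (suc x)
  count-suc x with U? x
  ... | yes _ = n≤1+n _
  ... | no _  = ≤-refl

  count-mono : ∀ {x y} → x ≤ y → count x ≤ count y
  count-mono {y = zero}  z≤n = ≤-refl
  count-mono {y = suc y} x≤1+y with m≤n⇒m<n∨m≡n x≤1+y
  ... | inj₁ x≤y  = ≤-trans (count-mono (s≤s⁻¹ x≤y)) (count-suc y)
  ... | inj₂ refl = ≤-refl

  count-< : ∀ {x y} → U x → x < y → count x < count y
  count-< x∈U x<y = subst (_≤ _) (count-yes x∈U) (count-mono x<y)

  count-injective : ∀ {x y} → U x → U y → count x ≡ count y → x ≡ y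
  count-injective {x} {y} x∈U y∈U eq with <-cmp x y
  ... | tri< x<y _ _ = ⊥-elim (<⇒≢ (count-< x∈U x<y) eq)
  ... | tri≈ _ x≡y _ = x≡y
  ... | tri> _ _ y<x = ⊥-elim (<⇒≢ (count-< y∈U y<x) (sym eq))

  -- No value is skipped, since each step raises `count` by at most one, and only at elements of
  -- `U`.
  count-attains : ∀ x {i} → i < count x → ∃[ y ] U y × count y ≡ i
  count-attains (suc x) {i} i<c with U? x
  ... | no _    = count-attains x i<c
  ... | yes x∈U with m≤n⇒m<n∨m≡n (s≤s⁻¹ i<c)
  ...   | inj₁ i<c′ = count-attains x i<c′
  ...   | inj₂ refl = x , x∈U , refl

  module _ (unbounded : Unbounded U) where

    count-unbounded : ∀ i → ∃[ x ] i < count x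
    count-unbounded zero = let x , _ , x∈U = unbounded 0 in
      suc x , subst (0 <_) (sym (count-yes x∈U)) (s≤s z≤n)
    count-unbounded (suc i) =
      let y , i<c = count-unbounded i
          x , y≤x , x∈U = unbounded y
      in suc x , subst (suc i <_) (sym (count-yes x∈U)) (s≤s (≤-trans i<c (count-mono y≤x)))

    count-surjective : ∀ i → ∃[ y ] U y × count y ≡ i
    count-surjective i = let x , i<c = count-unbounded i in count-attains x i<c

module ToEven {U : Pred ℕ 0ℓ} (U? : Decidable U)
              (inf : Unbounded U) (coinf : Unbounded (∁ U)) where

  private
    module In  = Count U?
    module Out = Count {∁ U} (λ x → ¬? (U? x))

  -- Ranks in `U` become even numbers and ranks in the complement odd ones. Applied to the keys
  -- whose number lies in `M`, this matches the keys that have a witness in the two structures; it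
  -- need not be computable.
  toEven : ℕ → ℕ
  toEven x with U? x
  ... | yes _ = In.count x + In.count x
  ... | no _  = suc (Out.count x + Out.count x)

  toEven-yes : ∀ {x} → U x → toEven x ≡ In.count x + In.count x
  toEven-yes {x} x∈U with U? x
  ... | yes _  = refl
  ... | no x∉U = ⊥-elim (x∉U x∈U)

  toEven-no : ∀ {x} → ¬ U x → toEven x ≡ suc (Out.count x + Out.count x)
  toEven-no {x} x∉U with U? x
  ... | yes x∈U = ⊥-elim (x∉U x∈U)
  ... | no _    = refl

  even⇒∈ : ∀ {x} → parityBit (toEven x) ≡ 0 → U x
  even⇒∈ {x} eq with U? x
  ... | yes x∈U = x∈U
  ... | no _    = ⊥-elim (0≢1+n (trans (sym eq) (parityBit-odd (Out.count x))))

  ∈⇒even : ∀ {x} → U x → parityBit (toEven x) ≡ 0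
  ∈⇒even {x} x∈U = trans (cong parityBit (toEven-yes x∈U)) (parityBit-even (In.count x))

  toEven-injective : ∀ {x y} → toEven x ≡ toEven y → x ≡ y
  toEven-injective {x} {y} eq with U? x | U? y
  ... | yes x∈U | yes y∈U = In.count-injective x∈U y∈U (double-injective eq)
  ... | no x∉U  | no y∉U  = Out.count-injective x∉U y∉U (double-injective (suc-injective eq))
  ... | yes _   | no _    = ⊥-elim (0≢1+n (trans (sym (parityBit-even (In.count x)))
                              (trans (cong parityBit eq) (parityBit-odd (Out.count y)))))
  ... | no _    | yes _   = ⊥-elim (0≢1+n (trans (sym (parityBit-even (In.count y)))
                              (trans (cong parityBit (sym eq)) (parityBit-odd (Out.count x)))))

  toEven-surjective : ∀ y → ∃[ x ] toEven x ≡ y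
  toEven-surjective y with halve y
  ... | i , inj₁ refl = let x , x∈U , eq = In.count-surjective inf i in
    x , trans (toEven-yes x∈U) (cong₂ _+_ eq eq)
  ... | i , inj₂ refl = let x , x∉U , eq = Out.count-surjective coinf i in
    x , trans (toEven-no x∉U) (cong suc (cong₂ _+_ eq eq))

  toEven-↔ : ℕ ↔ ℕ
  toEven-↔ = ⤖⇒↔ (mk⤖ (toEven-injective ,
    λ y → let x , eq = toEven-surjective y in x , λ { refl → eq }))

-- The transposition of `a` and 0. It will move the stage at which a number enters `M` to 0, the
-- only stage accepted in `𝓑`.
swapZero : ℕ → ℕ → ℕ
swapZero a x with x ≟ a | x ≟ 0
... | yes _ | _     = 0
... | no _  | yes _ = a
... | no _  | no _  = x

swapZero-at : ∀ a → swapZero a a ≡ 0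
swapZero-at a with a ≟ a | a ≟ 0
... | yes _  | _ = refl
... | no a≢a | _ = ⊥-elim (a≢a refl)

swapZero-zero : ∀ a → swapZero a 0 ≡ a
swapZero-zero zero    = refl
swapZero-zero (suc a) = refl

swapZero-other : ∀ {a x} → x ≢ a → x ≢ 0 → swapZero a x ≡ x
swapZero-other {a} {x} x≢a x≢0 with x ≟ a | x ≟ 0
... | yes x≡a | _       = ⊥-elim (x≢a x≡a)
... | no _    | yes x≡0 = ⊥-elim (x≢0 x≡0)
... | no _    | no _    = refl

swapZero-involutive : ∀ a x → swapZero a (swapZero a x) ≡ x
swapZero-involutive a x with x ≟ a | x ≟ 0
... | yes refl | _        = swapZero-zero a
... | no _     | yes refl = swapZero-at a
... | no x≢a   | no x≢0   = swapZero-other x≢a x≢0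

swapZero-↔ : ℕ → ℕ ↔ ℕ
swapZero-↔ a = mk↔ₛ′ (swapZero a) (swapZero a) (swapZero-involutive a) (swapZero-involutive a)

swapZero≡0⇒≡ : ∀ {a x} → swapZero a x ≡ 0 → x ≡ a
swapZero≡0⇒≡ {a} {x} eq =
  trans (sym (swapZero-involutive a x)) (trans (cong (swapZero a) eq) (swapZero-zero a))

-- Structures with two binary relations

isZero : ℕ → Bool
isZero zero    = true
isZero (suc _) = false

isZero⁺ : ∀ {x} → x ≡ 0 → T (isZero x)
isZero⁺ refl = tt

isZero⁻ : ∀ {x} → T (isZero x) → x ≡ 0
isZero⁻ {zero} _ = refl

isZeroᵀ : Total n → Total n
isZeroᵀ t = recast (ifZeroᵀ v0 (const 1) (const 0)) (λ { (x ∷ []) → bit (isZero x) })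
  (λ { (zero ∷ []) → refl ; (suc x ∷ []) → refl }) ∘ᵀ (t ∷ [])

everything nothing : ComputableSet
everything = record { char = λ _ → true  ; charᴾ = constᴾ 1 ; charᴾ-correct = λ x → constᴾ-correct 1 (x ∷ []) }
nothing    = record { char = λ _ → false ; charᴾ = Z        ; charᴾ-correct = λ _ → refl }

-- The symbols other than 0 all denote the same relation.

L : Language
L = record
  { functions = nothing ; predicates = everything ; constants = nothing
  ; farity = λ _ → 0 ; farityᴾ = Z ; farityᴾ-correct = λ _ → refl
  ; parity = λ _ → 2 ; parityᴾ = constᴾ 2 ; parityᴾ-correct = λ P → constᴾ-correct 2 (proj₁ P ∷ [])
  }

pattern E = 0 , tt
pattern R = 1 , tt

module Relational (e r : Total 2) where

  relᵀ : Total 2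
  relᵀ = ifZeroᵀ v0 (e ∘ᵀ args) (r ∘ᵀ args)
    where
    args : Vec (Total 2) 2
    -- The code of two arguments is `pair x (pair y 0)`, because the empty tuple is coded by 0.
    args = fstᵀ v1 ∷ fstᵀ (sndᵀ v1) ∷ []

  Rel : ℕ → ℕ → ℕ → Set
  Rel i x y = ifZero i (value e (x ∷ y ∷ [])) (value r (x ∷ y ∷ [])) ≡ 0

  relational : ComputableStructure L
  relational = record
    { universe = everything
    ; nonempty = 0 , tt
    ; fun      = λ { (_ , ()) }
    ; pred     = λ P as → isZero (value relᵀ (proj₁ P ∷ ⟨ map proj₁ as ⟩ ∷ []))
    ; const    = λ { (_ , ()) }
    ; funᴾ     = Z
    ; predᴾ    = code (isZeroᵀ relᵀ)
    ; constantᴾ = Z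
    ; funᴾ-correct  = λ { (_ , ()) }
    ; predᴾ-correct = λ P as → correct (isZeroᵀ relᵀ) (proj₁ P ∷ ⟨ map proj₁ as ⟩ ∷ [])
    ; constantᴾ-correct = λ { (_ , ()) }
    }

  value-relᵀ : ∀ i x y → value relᵀ (i ∷ ⟨ x ∷ y ∷ [] ⟩ ∷ []) ≡
               ifZero i (value e (x ∷ y ∷ [])) (value r (x ∷ y ∷ []))
  value-relᵀ i x y = cong₂ (λ x′ y′ → ifZero i (value e (x′ ∷ y′ ∷ [])) (value r (x′ ∷ y′ ∷ [])))
    (fst-pair x ⟨ y ∷ [] ⟩) (trans (cong fst (snd-pair x ⟨ y ∷ [] ⟩)) (fst-pair y 0))

  open ComputableStructure relational using () renaming (pred to predicate)

  pred⇔Rel : ∀ i {x y} → T (predicate (i , tt) ((x , tt) ∷ (y , tt) ∷ [])) ⇔ Rel i x y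
  pred⇔Rel i {x} {y} = mk⇔ (λ p → trans (sym (value-relᵀ i x y)) (isZero⁻ p))
                           (λ q → isZero⁺ (trans (value-relᵀ i x y) q))

  module _ {C : Pred ℕ 0ℓ} where

    open CohesivePower C relational

    holds⁻ : ∀ i {φ ψ} → holds (i , tt) (φ ∷ ψ ∷ []) →
             C ⊆* λ x → ∃[ u ] ∃[ v ] ⟦ program φ ⟧ (x ∷ []) u × ⟦ program ψ ⟧ (x ∷ []) v × Rel i u v
    holds⁻ i = ⊆*-weaken λ { (_ , p ∷ q ∷ [] , h) → _ , _ , p , q , Equivalence.to (pred⇔Rel i) h }

    holds⁺ : ∀ i {φ ψ} →
             (C ⊆* λ x → ∃[ u ] ∃[ v ] ⟦ program φ ⟧ (x ∷ []) u × ⟦ program ψ ⟧ (x ∷ []) v × Rel i u v) →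
             holds (i , tt) (φ ∷ ψ ∷ [])
    holds⁺ i = ⊆*-weaken λ { (u , v , p , q , h) →
      (u , tt) ∷ (v , tt) ∷ [] , p ∷ q ∷ [] , Equivalence.from (pred⇔Rel i) h }

relational-≅ : ∀ e r e′ r′ (θ : ℕ ↔ ℕ) →
               (∀ i x y → Relational.Rel e r i x y ⇔ Relational.Rel e′ r′ i (to θ x) (to θ y)) →
               structure (Relational.relational e r) ≅ structure (Relational.relational e′ r′)
relational-≅ e r e′ r′ θ pres = record
  { bijection = record
    { to        = λ (x , _) → to θ x , tt
    ; cong      = λ { refl → refl }
    ; bijective =
        (λ {x} {y} eq → cong (_, tt) (trans (sym (strictlyInverseʳ θ (proj₁ x)))
          (trans (cong (from θ ∘ proj₁) eq) (strictlyInverseʳ θ (proj₁ y))))) ,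
        λ (y , _) → (from θ y , tt) , λ { refl → cong (_, tt) (strictlyInverseˡ θ y) }
    }
  ; preserves-fun   = λ { (_ , ()) }
  ; preserves-pred  = λ { (i , tt) ((x , tt) ∷ (y , tt) ∷ []) → mk⇔
      (λ p → Equivalence.from (pred⇔Rel e′ r′ i) (Equivalence.to (pres i x y) (Equivalence.to (pred⇔Rel e r i) p)))
      (λ p → Equivalence.from (pred⇔Rel e r i) (Equivalence.from (pres i x y) (Equivalence.to (pred⇔Rel e′ r′ i) p))) }
  ; preserves-const = λ { (_ , ()) }
  }
  where open Relational using (pred⇔Rel)

-- The sentence that separates the powers.

Good : Structure L → Set
Good 𝓢 = ∀ x → ∃[ y ] predicate E (x ∷ y ∷ []) × (∀ z → ¬ predicate R (y ∷ z ∷ []))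
  where open Structure 𝓢 using () renaming (pred to predicate)

-- Domains are setoids, so surjectivity yields `y` with `f y` only equivalent to `y′`; `pred-resp`
-- carries the relations across.
Good-≅ : ∀ {𝓜 𝓝} → 𝓜 ≅ 𝓝 → Good 𝓝 → Good 𝓜
Good-≅ {𝓜} {𝓝} iso good x =
  let y′ , e , ¬r = good (f x)
      y , fy≈ = strictlySurjective y′
  in y ,
     Equivalence.from (preserves-pred E (x ∷ y ∷ [])) (N.pred-resp E (N.refl ∷ N.sym fy≈ ∷ []) e) ,
     λ z r → ¬r (f z) (N.pred-resp R (fy≈ ∷ N.refl ∷ [])
       (Equivalence.to (preserves-pred R (y ∷ z ∷ [])) r))
  where
  open _≅_ iso renaming (to to f)
  open Bijection bijection using (strictlySurjective)
  module N where
    open Structure 𝓝 public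
    open Setoid domain public using (refl; sym)

-- Triples

class key stage : ℕ → ℕ
class u = fst u
key   u = fst (snd u)
stage u = snd (snd u)

triple : ℕ → ℕ → ℕ → ℕ
triple n k s = pair n (pair k s)

class-triple : ∀ n k s → class (triple n k s) ≡ n
class-triple n k s = fst-pair n (pair k s)

key-triple : ∀ n k s → key (triple n k s) ≡ k
key-triple n k s = trans (cong fst (snd-pair n (pair k s))) (fst-pair k s)

stage-triple : ∀ n k s → stage (triple n k s) ≡ s
stage-triple n k s = trans (cong snd (snd-pair n (pair k s))) (snd-pair k s)

triple-↔ : ℕ ↔ (Σ[ n ∈ ℕ ] Σ[ k ∈ ℕ ] ℕ)
triple-↔ = mk↔ₛ′ (λ u → class u , key u , stage u) (λ (n , k , s) → triple n k s)
  (λ (n , k , s) → cong₂ _,_ (class-triple n k s) (cong₂ _,_ (key-triple n k s) (stage-triple n k s)))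
  (λ u → trans (cong (pair (fst u)) (pair-fst-snd (snd u))) (pair-fst-snd u))

classᵀ keyᵀ stageᵀ : ∀ {n} → Total n → Total n
classᵀ t = fstᵀ t
keyᵀ   t = fstᵀ (sndᵀ t)
stageᵀ t = sndᵀ (sndᵀ t)

tripleᵀ : ∀ {n} → Total n → Total n → Total n → Total n
tripleᵀ r s t = pairᵀ r (pairᵀ s t)

distᵀ : ∀ {n} → Total n → Total n → Total n
distᵀ s t = (s ∸ᵀ t) +ᵀ (t ∸ᵀ s)

dist≡0⇔≡ : ∀ {x y} → (x ∸ y) + (y ∸ x) ≡ 0 ⇔ x ≡ y
dist≡0⇔≡ {x} {y} = mk⇔
  (λ eq → ≤-antisym (m∸n≡0⇒m≤n (m+n≡0⇒m≡0 (x ∸ y) eq)) (m∸n≡0⇒m≤n (m+n≡0⇒n≡0 (x ∸ y) eq)))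
  (λ { refl → m+n≡0 (n∸n≡0 x) (n∸n≡0 x) })

sameClassᵀ : Total 2
sameClassᵀ = distᵀ (classᵀ v0) (classᵀ v1)

sameClass⇔ : ∀ u v → value sameClassᵀ (u ∷ v ∷ []) ≡ 0 ⇔ class u ≡ class v
sameClass⇔ u v = dist≡0⇔≡ {class u} {class v}

witnessᵀ : Total 3 → Total 2
witnessᵀ q = sameClassᵀ +ᵀ (distᵀ (keyᵀ v0) (keyᵀ v1) +ᵀ q ∘ᵀ (classᵀ v1 ∷ keyᵀ v1 ∷ stageᵀ v1 ∷ []))

Witness : Total 3 → ℕ → ℕ → Set
Witness q u v = class u ≡ class v × key u ≡ key v × value q (class v ∷ key v ∷ stage v ∷ []) ≡ 0

witness⇔ : ∀ q {u v} → value (witnessᵀ q) (u ∷ v ∷ []) ≡ 0 ⇔ Witness q u v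
witness⇔ q {u} {v} = mk⇔
  (λ eq → let eq′ = m+n≡0⇒n≡0 (value sameClassᵀ (u ∷ v ∷ [])) eq in
    Equivalence.to dist≡0⇔≡ (m+n≡0⇒m≡0 (value sameClassᵀ (u ∷ v ∷ [])) eq) ,
    Equivalence.to dist≡0⇔≡ (m+n≡0⇒m≡0 ((key u ∸ key v) + (key v ∸ key u)) eq′) ,
    m+n≡0⇒n≡0 ((key u ∸ key v) + (key v ∸ key u)) eq′)
  (λ (c , k , w) → m+n≡0 (Equivalence.from dist≡0⇔≡ c) (m+n≡0 (Equivalence.from dist≡0⇔≡ k) w))

triples : Total 3 → ComputableStructure L
triples q = Relational.relational sameClassᵀ (witnessᵀ q)

-- The map sends `(n , k , s)` to `(n , σ n k , τ n k s)`. Permutations depending on earlier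
-- components are harmless, since `R` relates only triples that agree in class and key, and inspects
-- the stage of the second one alone.
triples-≅ : ∀ {q q′} (σ : ℕ → ℕ ↔ ℕ) (τ : ℕ → ℕ → ℕ ↔ ℕ) →
            (∀ n k s → value q (n ∷ k ∷ s ∷ []) ≡ 0 ⇔
                       value q′ (n ∷ to (σ n) k ∷ to (τ n k) s ∷ []) ≡ 0) →
            structure (triples q) ≅ structure (triples q′)
triples-≅ {q} {q′} σ τ pres = relational-≅ sameClassᵀ (witnessᵀ q) sameClassᵀ (witnessᵀ q′) θ preserves
  where
  θ : ℕ ↔ ℕ
  θ = ↔-sym triple-↔ ↔-∘ (Σ-↔ (↔-id ℕ) (λ {n} → Σ-↔ (σ n) (λ {k} → τ n k)) ↔-∘ triple-↔)

  class-θ : ∀ u → class (to θ u) ≡ class u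
  class-θ u = class-triple (class u) (to (σ (class u)) (key u)) (to (τ (class u) (key u)) (stage u))

  key-θ : ∀ u → key (to θ u) ≡ to (σ (class u)) (key u)
  key-θ u = key-triple (class u) (to (σ (class u)) (key u)) (to (τ (class u) (key u)) (stage u))

  stage-θ : ∀ u → stage (to θ u) ≡ to (τ (class u) (key u)) (stage u)
  stage-θ u = stage-triple (class u) (to (σ (class u)) (key u)) (to (τ (class u) (key u)) (stage u))

  class⇔ : ∀ u v → class u ≡ class v ⇔ class (to θ u) ≡ class (to θ v)
  class⇔ u v = mk⇔ (λ eq → trans (class-θ u) (trans eq (sym (class-θ v))))
                       (λ eq → trans (sym (class-θ u)) (trans eq (class-θ v)))

  value-θ : ∀ v → value q′ (class (to θ v) ∷ key (to θ v) ∷ stage (to θ v) ∷ []) ≡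
            value q′ (class v ∷ to (σ (class v)) (key v) ∷ to (τ (class v) (key v)) (stage v) ∷ [])
  value-θ v = cong (value q′) (cong₂ _∷_ (class-θ v) (cong₂ _∷_ (key-θ v) (cong (_∷ []) (stage-θ v))))

  witness-θ⁺ : ∀ {u v} → Witness q u v → Witness q′ (to θ u) (to θ v)
  witness-θ⁺ {u} {v} (c , k , w) =
    Equivalence.to (class⇔ u v) c ,
    trans (key-θ u) (trans (cong₂ (λ n → to (σ n)) c k) (sym (key-θ v))) ,
    trans (value-θ v) (Equivalence.to (pres (class v) (key v) (stage v)) w)

  witness-θ⁻ : ∀ {u v} → Witness q′ (to θ u) (to θ v) → Witness q u v
  witness-θ⁻ {u} {v} (c , k , w) =
    c′ ,
    -- As the classes agree, one and the same permutation has moved both keys.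
    Bijection.injective (↔⇒⤖ (σ (class v)))
      (trans (cong (λ n → to (σ n) (key u)) (sym c′)) (trans (sym (key-θ u)) (trans k (key-θ v)))) ,
    Equivalence.from (pres (class v) (key v) (stage v)) (trans (sym (value-θ v)) w)
    where
    c′ : class u ≡ class v
    c′ = Equivalence.from (class⇔ u v) c

  open Relational

  preserves : ∀ i u v → Rel sameClassᵀ (witnessᵀ q) i u v ⇔
                        Rel sameClassᵀ (witnessᵀ q′) i (to θ u) (to θ v)
  preserves zero    u v = mk⇔
    (λ h → Equivalence.from (sameClass⇔ (to θ u) (to θ v)) (Equivalence.to (class⇔ u v) (Equivalence.to (sameClass⇔ u v) h)))
    (λ h → Equivalence.from (sameClass⇔ u v) (Equivalence.from (class⇔ u v) (Equivalence.to (sameClass⇔ (to θ u) (to θ v)) h)))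
  preserves (suc i) u v = mk⇔
    (λ h → Equivalence.from (witness⇔ q′ {to θ u} {to θ v}) (witness-θ⁺ {u} {v} (Equivalence.to (witness⇔ q {u} {v}) h)))
    (λ h → Equivalence.from (witness⇔ q {u} {v}) (witness-θ⁻ {u} {v} (Equivalence.to (witness⇔ q′ {to θ u} {to θ v}) h)))

post : ∀ {n} → Total 1 → PR n → PR n
post t q = comp (code t) (q ∷ [])

post⁺ : ∀ {n} (t : Total 1) (q : PR n) {xs u} → ⟦ q ⟧ xs u → ⟦ post t q ⟧ xs (value t (u ∷ []))
post⁺ t q {u = u} r = u ∷ [] , (r , tt) , correct t (u ∷ [])

post⁻ : ∀ {n} (t : Total 1) (q : PR n) {xs y} → ⟦ post t q ⟧ xs y →
        ∃[ u ] ⟦ q ⟧ xs u × y ≡ value t (u ∷ [])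
post⁻ t q (u ∷ [] , (r , _) , r′) = u , r , deterministic (code t) r′ (correct t (u ∷ []))

-- Stages of an enumeration

module Enumeration {M : Pred ℕ 0ℓ} (p : PR 1) (M≐ : M ≐ dom p) where

  runningᵀ : Total 2
  runningᵀ = const 1 ∸ᵀ eval p

  pendingᵀ : Total 2
  pendingᵀ = recᵀ (const 0) (v1 +ᵀ eval p ∘ᵀ (v0 ∷ v2 ∷ []))

  -- Zero when `s` is the first fuel with an output: `runningᵀ` vanishes once there is one, and
  -- `pendingᵀ` adds up the outputs for all smaller fuels. Being first makes the stage unique, like
  -- the single stage 0 in `𝓑`.
  entersᵀ : Total 2
  entersᵀ = runningᵀ +ᵀ pendingᵀ

  Enters : ℕ → ℕ → Set
  Enters s x = value entersᵀ (s ∷ x ∷ []) ≡ 0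

  output : ℕ → ℕ → ℕ
  output s x = value (eval p) (s ∷ x ∷ [])

  pending⁺ : ∀ s {x} → (∀ t → t < s → output t x ≡ 0) → value pendingᵀ (s ∷ x ∷ []) ≡ 0
  pending⁺ zero    h = refl
  pending⁺ (suc s) h = m+n≡0 (pending⁺ s λ t t<s → h t (m<n⇒m<1+n t<s)) (h s ≤-refl)

  pending⁻ : ∀ s {x} → value pendingᵀ (s ∷ x ∷ []) ≡ 0 → ∀ t → t < s → output t x ≡ 0
  pending⁻ (suc s) {x} eq t t<1+s with m≤n⇒m<n∨m≡n (s≤s⁻¹ t<1+s)
  ... | inj₁ t<s  = pending⁻ s (m+n≡0⇒m≡0 (value pendingᵀ (s ∷ x ∷ [])) eq) t t<s
  ... | inj₂ refl = m+n≡0⇒n≡0 (value pendingᵀ (s ∷ x ∷ [])) eq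

  running⇒0 : ∀ {z r} → 1 ∸ z ≡ suc r → z ≡ 0
  running⇒0 {zero}  _  = refl
  running⇒0 {suc z} eq = ⊥-elim (0≢1+n (trans (sym (0∸n≡0 z)) eq))

  ¬running⇒suc : ∀ {z} → 1 ∸ z ≡ 0 → ∃[ y ] z ≡ suc y
  ¬running⇒suc {suc z} _ = z , refl

  ∈⇒output : ∀ {x} → M x → ∃[ s ] ∃[ y ] output s x ≡ suc y
  ∈⇒output x∈M = let y , u = proj₁ M≐ x∈M ; s , h = eval-complete p _ u in s , y , h s ≤-refl

  output⇒∈ : ∀ {s x y} → output s x ≡ suc y → M x
  output⇒∈ eq = proj₂ M≐ (_ , eval-sound p _ _ eq)

  ∈⇒enters : ∀ {x} → M x → ∃[ s ] Enters s x
  ∈⇒enters {x} x∈M =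
    let s , y , eq = ∈⇒output x∈M
        t , stop , run = least (λ s → value runningᵀ (s ∷ x ∷ [])) s
                           (trans (cong (1 ∸_) eq) (0∸n≡0 y))
    in t , m+n≡0 stop (pending⁺ t λ w w<t → running⇒0 (proj₂ (run w w<t)))

  enters⇒output : ∀ {s x} → Enters s x → ∃[ y ] output s x ≡ suc y
  enters⇒output {s} {x} e = ¬running⇒suc (m+n≡0⇒m≡0 (value runningᵀ (s ∷ x ∷ [])) e)

  enters⇒∈ : ∀ {s x} → Enters s x → M x
  enters⇒∈ e = output⇒∈ (proj₂ (enters⇒output e))

  ¬enters-< : ∀ {s t x} → Enters s x → Enters t x → ¬ s < t
  ¬enters-< {s} {t} {x} e e′ s<t =
    let y , eq = enters⇒output {s} e
    in 0≢1+n (trans (sym (pending⁻ t (m+n≡0⇒n≡0 (value runningᵀ (t ∷ x ∷ [])) e′) s s<t)) eq)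

  enters-unique : ∀ {s t x} → Enters s x → Enters t x → s ≡ t
  enters-unique {s} {t} e e′ = ≤-antisym (≮⇒≥ (¬enters-< {t} {s} e′ e)) (≮⇒≥ (¬enters-< {s} {t} e e′))

-- The structures belonging to a co-maximal set, and their powers.

Cohesive-≐ : ∀ {C D} → C ≐ D → Cohesive D → Cohesive C
Cohesive-≐ {C} {D} (C⊆D , D⊆C) (inf , split) =
  (λ (l , h) → inf (l , λ x∈D → h (D⊆C x∈D))) ,
  λ W ce → shrink (split W ce)
  where
  shrink : ∀ {W} → Finite (W ∩ D) ⊎ Finite (∁ W ∩ D) → Finite (W ∩ C) ⊎ Finite (∁ W ∩ C)
  shrink (inj₁ (l , h)) = inj₁ (l , λ (w , c) → h (w , C⊆D c))
  shrink (inj₂ (l , h)) = inj₂ (l , λ (w , c) → h (w , C⊆D c))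

module Main (em : ExcludedMiddle 0ℓ) {C M : Pred ℕ 0ℓ} (p : PR 1) (M≐ : M ≐ dom p)
            (cohesive : Cohesive C) (C≐ : C ≐ ∁ M) where

  open Classical em
  open Enumeration p M≐

  ∉C⇒∈M : ∀ {x} → ¬ C x → M x
  ∉C⇒∈M {x} x∉C with em {M x}
  ... | yes x∈M = x∈M
  ... | no x∉M  = ⊥-elim (x∉C (proj₂ C≐ x∉M))

  C-unbounded : Unbounded C
  C-unbounded = infinite⇒unbounded (proj₁ cohesive)

  -- If `M` had no elements from `b` on, then `C` would contain everything there and the successor
  -- function would bound its gaps.
  M-unbounded : Unbounded M
  M-unbounded b with em {∃[ x ] b ≤ x × M x}
  ... | yes found = found
  ... | no ¬found = ⊥-elim (Blocks.contradiction em cohesive (sucᵀ v0) b λ n b≤n _ →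
    suc n , proj₂ C≐ (λ m → ¬found (suc n , m≤n⇒m≤1+n b≤n , m)) , ≤-refl , ≤-refl)

  shift-unbounded : ∀ {X} n → Unbounded X → Unbounded λ k → X (suc (n + k))
  shift-unbounded {X} n unb b = let x , le , x∈X = unb (suc (n + b)) in
    x ∸ suc n , m+n≤o⇒m≤o∸n b (subst (_≤ x) (+-comm (suc n) b) le) , subst X (sym (m+[n∸m]≡n (≤-trans (s≤s (m≤m+n n b)) le))) x∈X

  -- Off C, where the program need not converge, the search ends because the
  -- argument is enumerated into M.

  total-extension : (q : PR 1) (b : ℕ) → (∀ x → b ≤ x → C x → dom q x) →
                    ∃[ g ] ∀ x → b ≤ x → C x → ⟦ q ⟧ (x ∷ []) (value g (x ∷ []))
  total-extension q b converges = predᵀ (eval q ∘ᵀ (fuelᵀ ∷ v0 ∷ [])) , λ x b≤x x∈C →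
    sound x b≤x x∈C (value fuelᵀ (x ∷ [])) (searchᵀ-zero unfinishedᵀ unfinished-zero (x ∷ []))
    where
    unfinishedᵀ : Total 2
    -- Subtracting a sum from 1 encodes a disjunction: the argument is below `b`, or `q` has an
    -- output, or `p` has one. The first case ends the search at once where nothing is assumed about
    -- `q`.
    unfinishedᵀ = const 1 ∸ᵀ ((const b ∸ᵀ v1) +ᵀ (eval q +ᵀ eval p))

    outputᵠ : ℕ → ℕ → ℕ
    outputᵠ s x = value (eval q) (s ∷ x ∷ [])

    unfinished-zero : ∀ xs → ∃[ s ] value unfinishedᵀ (s ∷ xs) ≡ 0
    unfinished-zero (x ∷ []) with b ≤? x
    ... | no b≰x = 0 , m≤n⇒m∸n≡0 (≤-trans (m<n⇒0<n∸m (≰⇒> b≰x)) (m≤m+n (b ∸ x) _))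
    ... | yes b≤x with em {C x}
    ...   | yes x∈C =
      let v , r = converges x b≤x x∈C ; s , e = eval-complete q (x ∷ []) r
          0<out = subst (1 ≤_) (sym (e s ≤-refl)) (s≤s z≤n)
      in s , m≤n⇒m∸n≡0 (≤-trans (≤-trans 0<out (m≤m+n (outputᵠ s x) (output s x)))
                                (m≤n+m (outputᵠ s x + output s x) (b ∸ x)))
    ...   | no x∉C =
      let s , y , e = ∈⇒output (∉C⇒∈M x∉C)
          0<out = subst (1 ≤_) (sym e) (s≤s z≤n)
      in s , m≤n⇒m∸n≡0 (≤-trans (≤-trans 0<out (m≤n+m (output s x) (outputᵠ s x)))
                                (m≤n+m (outputᵠ s x + output s x) (b ∸ x)))

    fuelᵀ : Total 1
    fuelᵀ = searchᵀ unfinishedᵀ unfinished-zero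

    sound : ∀ x → b ≤ x → C x → ∀ s → value unfinishedᵀ (s ∷ x ∷ []) ≡ 0 →
            ⟦ q ⟧ (x ∷ []) (pred (outputᵠ s x))
    sound x b≤x x∈C s eq with outputᵠ s x in eqᵠ
    ... | suc v = eval-sound q s (x ∷ []) eqᵠ
    ... | zero with output s x in eqᵖ
    ...   | suc y = ⊥-elim (proj₁ C≐ x∈C (output⇒∈ {s} eqᵖ))
    ...   | zero  = ⊥-elim (0≢1+n (trans (sym eq) (cong (1 ∸_) (m+n≡0 (m≤n⇒m∸n≡0 b≤x) refl))))

  -- The successor in `qᴬ` makes the number attached to a key exceed the class `n`, so that a key
  -- without witness yields an element of `C` strictly above `n`.
  qᴬ qᴮ : Total 3
  qᴬ = entersᵀ ∘ᵀ (v2 ∷ sucᵀ (v0 +ᵀ v1) ∷ [])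
  qᴮ = parityᵀ v1 +ᵀ v2
    where
    parityᵀ : ∀ {n} → Total n → Total n
    parityᵀ t = recast rec (λ { (x ∷ []) → parityBit x }) (λ { (x ∷ []) → go x }) ∘ᵀ (t ∷ [])
      where
      rec : Total 1
      rec = recᵀ (const 0) (const 1 ∸ᵀ v1)
      go : ∀ x → value rec (x ∷ []) ≡ parityBit x
      go zero    = refl
      go (suc x) = cong (1 ∸_) (go x)

  𝓐 𝓑 : ComputableStructure L
  𝓐 = triples qᴬ
  𝓑 = triples qᴮ

  module Key (n : ℕ) where
    InM : Pred ℕ 0ℓ
    InM k = M (suc (n + k))

    coinfinite : Unbounded (∁ InM)
    coinfinite b = let k , b≤k , c = shift-unbounded n C-unbounded b in k , b≤k , proj₁ C≐ c

    open ToEven {InM} (λ _ → em) (shift-unbounded n M-unbounded) coinfinite public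

  -- The decision is an argument so that `τ⁺` and `τ⁻` can split on it. For a number outside `M` no
  -- stage gives a witness in `𝓐`, nor in `𝓑` after the key has become odd, so the identity serves.
  τ : ∀ {x} → Dec (M x) → ℕ ↔ ℕ
  τ (yes x∈M) = swapZero-↔ (proj₁ (∈⇒enters x∈M))
  τ (no _)    = ↔-id ℕ

  𝓐≅𝓑 : structure 𝓐 ≅ structure 𝓑
  𝓐≅𝓑 = triples-≅ {qᴬ} {qᴮ} Key.toEven-↔ (λ n k → τ (em {M (suc (n + k))})) λ n k s →
    mk⇔ (λ e → m+n≡0 (Key.∈⇒even n (enters⇒∈ {s} e)) (τ⁺ {suc (n + k)} {s} em e))
        (λ eq → τ⁻ {suc (n + k)} {s} em (Key.even⇒∈ n (m+n≡0⇒m≡0 (parityBit (Key.toEven n k)) eq))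
                     (m+n≡0⇒n≡0 (parityBit (Key.toEven n k)) eq))
    where
    τ⁺ : ∀ {x s} (d : Dec (M x)) → Enters s x → to (τ d) s ≡ 0
    τ⁺ {x} {s} (yes x∈M) e with refl ← enters-unique {s} e (proj₂ (∈⇒enters x∈M)) = swapZero-at s
    τ⁺ {x} {s} (no x∉M)  e = ⊥-elim (x∉M (enters⇒∈ {s} e))

    τ⁻ : ∀ {x s} (d : Dec (M x)) → M x → to (τ d) s ≡ 0 → Enters s x
    τ⁻ {x} (yes x∈M) _ eq =
      subst (λ s → Enters s x) (sym (swapZero≡0⇒≡ eq)) (proj₂ (∈⇒enters x∈M))
    τ⁻ (no x∉M) x∈M _ = ⊥-elim (x∉M x∈M)

  module A = CohesivePower C 𝓐
  module B = CohesivePower C 𝓑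

  good-B : Good (Π[ C ] 𝓑)
  good-B φ = ψ , holds-E , no-witness
    where
    oddᵀ : Total 1
    -- Key 1 is odd, so this triple has no witness in `𝓑`, whatever its class.
    oddᵀ = tripleᵀ (classᵀ v0) (const 1) (const 0)

    ψ : B.D
    ψ = record
      { program = post oddᵀ (B.program φ)
      ; into    = λ _ _ _ → tt
      ; almost  = ⊆*-weaken (λ (u , r) → _ , post⁺ oddᵀ (B.program φ) r) (B.almost φ)
      }

    holds-E : B.holds E (φ ∷ ψ ∷ [])
    holds-E = Relational.holds⁺ sameClassᵀ (witnessᵀ qᴮ) 0 {φ} {ψ}
      (⊆*-weaken (λ (u , r) → u , _ , r , post⁺ oddᵀ (B.program φ) r ,
                    Equivalence.from dist≡0⇔≡ (sym (class-triple (class u) 1 0)))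
                 (B.almost φ))

    no-witness : ∀ χ → ¬ B.holds R (ψ ∷ χ ∷ [])
    no-witness χ h =
      let b , imp = ⊆*⇒eventually (Relational.holds⁻ sameClassᵀ (witnessᵀ qᴮ) 1 {ψ} {χ} h)
          -- A single point of `C` at which the relation holds suffices for the contradiction.
          x , b≤x , x∈C = C-unbounded b
          u , v , r , _ , rel = imp x b≤x x∈C
          w , _ , eq = post⁻ oddᵀ (B.program φ) r
          _ , k , q = Equivalence.to (witness⇔ qᴮ) rel
          key-u≡1 = trans (cong key eq) (key-triple (class w) 1 0)
      in 0≢1+n (trans (sym (m+n≡0⇒m≡0 (parityBit (key v)) q))
                      (cong parityBit (trans (sym k) key-u≡1)))

  module NotGood (good : Good (Π[ C ] 𝓐)) where

    ιᵀ : Total 1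
    ιᵀ = tripleᵀ v0 (const 0) (const 0)

    ι : A.D
    ι = record { program = code ιᵀ ; into = λ _ _ _ → tt
               ; almost = ⊆*-total λ x → _ , correct ιᵀ (x ∷ []) }

    ψ : A.D
    ψ = proj₁ (good ι)

    ψ-class : Eventually λ x → C x → ∃[ v ] ⟦ A.program ψ ⟧ (x ∷ []) v × class v ≡ x
    ψ-class =
      let b , h = ⊆*⇒eventually
                    (Relational.holds⁻ sameClassᵀ (witnessᵀ qᴬ) 0 {ι} {ψ} (proj₁ (proj₂ (good ι))))
      in b , λ x b≤x x∈C →
        let u , v , r , r′ , rel = h x b≤x x∈C
        in v , r′ , trans (sym (Equivalence.to (sameClass⇔ u v) rel))
             (trans (cong class (deterministic (code ιᵀ) r (correct ιᵀ (x ∷ []))))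
                    (class-triple x 0 0))

    targetᵀ : Total 1
    targetᵀ = sucᵀ (classᵀ v0 +ᵀ keyᵀ v0)

    target : ℕ → ℕ
    target v = suc (class v + key v)

    targetᴾ : PR 1
    targetᴾ = post targetᵀ (A.program ψ)

    -- The arguments at which the value of `ψ` has a witness in `𝓐`. This set is c.e., so by
    -- cohesiveness `C` is almost contained in it or in its complement, and each case is refuted
    -- separately.
    W : Pred ℕ 0ℓ
    W x = ∃[ v ] ⟦ A.program ψ ⟧ (x ∷ []) v × M (target v)

    W-CE : CE W
    W-CE = comp p (targetᴾ ∷ []) ,
      (λ (v , r , m) → let y , r′ = proj₁ M≐ m in
        y , target v ∷ [] , (post⁺ targetᵀ (A.program ψ) r , tt) , r′) ,
      λ { (y , _ ∷ [] , (t , _) , r′) →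
          let v , r , eq = post⁻ targetᵀ (A.program ψ) t
          in v , r , proj₂ M≐ (y , subst (λ z → ⟦ p ⟧ (z ∷ []) y) eq r′) }

    -- Almost everywhere on C the value of ψ has a witness, and the stage of
    -- the enumeration supplies it computably.

    W-almost⇒⊥ : (Eventually λ x → C x → W x) → ⊥
    W-almost⇒⊥ ev = proj₂ (proj₂ (good ι)) χ
      (Relational.holds⁺ sameClassᵀ (witnessᵀ qᴬ) 1 {ψ} {χ}
        (eventually⇒⊆* (eventually-map (λ f x∈C → witnessed (f x∈C)) ev)))
      where
      withStageᵀ : Total 2
      withStageᵀ = tripleᵀ (classᵀ v0) (keyᵀ v0) v1

      χᴾ : PR 1
      χᴾ = comp (code withStageᵀ) (A.program ψ ∷ comp (mu (code entersᵀ)) (targetᴾ ∷ []) ∷ [])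

      witnessed : ∀ {x} → W x → ∃[ v ] ∃[ w ] ⟦ A.program ψ ⟧ (x ∷ []) v × ⟦ χᴾ ⟧ (x ∷ []) w ×
                  value (witnessᵀ qᴬ) (v ∷ w ∷ []) ≡ 0
      witnessed (v , r , m) =
        let s₀ , e₀ = ∈⇒enters m
            s , r′ , e = mu-converges entersᵀ {s₀} (target v ∷ []) e₀
            c = class-triple (class v) (key v) s
            k = key-triple (class v) (key v) s
            t = stage-triple (class v) (key v) s
        in v , triple (class v) (key v) s , r ,
           (v ∷ s ∷ [] ,
            (r , (target v ∷ [] , (post⁺ targetᵀ (A.program ψ) r , tt) , r′) , tt) ,
            correct withStageᵀ (v ∷ s ∷ [])) ,
           Equivalence.from (witness⇔ qᴬ) (sym c , sym k ,
             subst₂ (λ s x → value entersᵀ (s ∷ x ∷ []) ≡ 0) (sym t)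
               (cong suc (cong₂ _+_ (sym c) (sym k))) e)

      χ : A.D
      χ = record
        { program = χᴾ
        ; into    = λ _ _ _ → tt
        ; almost  = eventually⇒⊆*
            (eventually-map (λ f x∈C → let _ , w , _ , r , _ = witnessed (f x∈C) in w , r) ev)
        }

    -- From `b` on, the total extension `g` agrees with `ψ` on `C`, so its target is itself the next
    -- element of `C` required by `Blocks`, and thus a computable bound for the gap.
    contradiction : ∀ b → (∀ x → b ≤ x → C x →
                     ∃[ v ] ⟦ A.program ψ ⟧ (x ∷ []) v × class v ≡ x × C (target v)) → ⊥
    contradiction b h = Blocks.contradiction em cohesive (targetᵀ ∘ᵀ (g ∷ [])) b next
      where
      extension : ∃[ g ] ∀ x → b ≤ x → C x → ⟦ A.program ψ ⟧ (x ∷ []) (value g (x ∷ []))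
      extension = total-extension (A.program ψ) b λ x b≤x x∈C →
        let v , r , _ = h x b≤x x∈C in v , r

      g : Total 1
      g = proj₁ extension

      next : ∀ x → b ≤ x → C x → ∃[ m ] C m × x < m × m ≤ target (value g (x ∷ []))
      next x b≤x x∈C =
        let v , r , c , t∈C = h x b≤x x∈C
        in target v , t∈C , s≤s (subst (_≤ class v + key v) c (m≤m+n (class v) (key v))) ,
           ≤-reflexive (cong target (deterministic (A.program ψ) r (proj₂ extension x b≤x x∈C)))

    ¬W-almost⇒⊥ : (Eventually λ x → C x → ¬ W x) → ⊥
    ¬W-almost⇒⊥ ev = let b , h = eventually-× ψ-class ev in
      contradiction b λ x b≤x x∈C →
        let v , r , c = proj₁ (h x b≤x) x∈C
        in v , r , c , proj₂ C≐ (λ m → proj₂ (h x b≤x) x∈C (v , r , m))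

    absurd : ⊥
    absurd with proj₂ cohesive W W-CE
    ... | inj₁ (l , h) = ¬W-almost⇒⊥ (⊆*⇒eventually {C} {∁ W} (l , λ {x} (x∈C , ¬¬w) →
                           h {x} (decidable-stable (em {W x}) ¬¬w , x∈C)))
    ... | inj₂ (l , h) = W-almost⇒⊥ (⊆*⇒eventually {C} {W} (l , λ {x} (x∈C , ¬w) →
                           h {x} (¬w , x∈C)))

theorem9 :
    ExcludedMiddle 0ℓ →
    (C : Pred ℕ 0ℓ) → CoMaximal C →
    Σ[ L ∈ Language ] Σ[ 𝓐 ∈ ComputableStructure L ] Σ[ 𝓑 ∈ ComputableStructure L ]
      (structure 𝓐 ≅ structure 𝓑) × ¬ (Π[ C ] 𝓐 ≅ Π[ C ] 𝓑)
theorem9 em C (M , ((p , M≐) , cohesive) , C≐) =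
  L , 𝓐 , 𝓑 , 𝓐≅𝓑 , λ iso → NotGood.absurd (Good-≅ iso good-B)
  where open Main em p M≐ (Cohesive-≐ C≐ cohesive) C≐
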